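{- Let $\mathcal{C}$ be either (a) a perfect code $\mathbf{x}+\mathcal{C}_0$ as below, with $\mathcal{S}$ the set of perfect Sudoku grids with respect to $\mathcal{C}$ and $\mathcal{G}_\mathcal{S}=\langle \tau_2^{x_1+x_2+1}\tau_1^{x_1-x_2}r,\ \tau_1^a\tau_2^b\rangle$, or (b) a diameter perfect code $\mathbf{x}+\mathcal{C}_0$ of Case I or Case II as below, with $\mathcal{S}$ the set of diameter perfect Sudoku grids with respect to $\mathcal{C}$ and $\mathcal{G}_\mathcal{S}=\langle \tau_1^{t+1}\tau_2^{t+1},\tau_2^{2(t+1)},\tau_2^{2x_2+1}s,\tau_1^{2x_1+2}\tau_2^{2x_2+1}r^2\rangle$ in Case I and $\mathcal{G}_\mathcal{S}=\langle \tau_1^{a}\tau_2^{b},\tau_1^{2x_1+2}\tau_2^{2x_2+1}r^2\rangle$ in Case II. Let $S_1,S_2\in\mathcal{S}$ with $S_2=\phi(S_1)$ for some $\phi\in\mathcal{G}_\mathcal{S}$. Then $\phi$ (applied to partially filled grids) is a bijection from the set of minimal Sudoku for $S_1$ onto the set of minimal Sudoku for $S_2$.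
   Context: $\mathbb{Z}_n$: integers mod $n$; Lee weight $\mathrm{wt}_L(u_1,u_2)=\sum_i\min\{u_i,n-u_i\}$ (entries in $\{0,\dots,n-1\}$), Lee distance $d_L(\mathbf{u},\mathbf{v})=\mathrm{wt}_L(\mathbf{u}-\mathbf{v})$; generator matrices generate codes as $\mathbb{Z}_n$-spans of rows; $\mathbf{x}=(x_1,x_2)\in\mathbb{Z}_n^2$. (a) Perfect case: $n=2t^2+2t+1$, $\mathcal{C}_0$ a linear code with generator matrix $[a~~b]$ having minimum Lee distance $2t+1$ and whose radius-$t$ Lee balls $\mathcal{B}_t(\mathbf{c})$ partition $\mathbb{Z}_n^2$; palette grid of $\mathcal{C}=\{\mathbf{c}_1,\dots,\mathbf{c}_n\}$: entry $i$ on $\mathcal{B}_t(\mathbf{c}_i)$. (b) Diameter case: $n=2(t+1)^2$, $\mathcal{C}_0$ linear of minimum Lee distance $2t+2$ and size $n$; $\mathcal{A}(\mathbf{c})$ = points within Lee distance $t$ of $\mathbf{c}$ or $\mathbf{c}+(1,0)$ (these partition $\mathbb{Z}_n^2$); palette grid: entry $i$ on $\mathcal{A}(\mathbf{c}_i)$. Case I: $\mathcal{C}_0$ equivalent (equal up to a coordinate permutation) to the code generated by $\begin{bmatrix}t+1&t+1\\0&2(t+1)\end{bmatrix}$; Case II: $\mathcal{C}_0$ has generator matrix $[a~~b]$ and is equivalent to the code generated by $[1~~2t+1]$. Palette grids are $n\times n$ arrays indexed by $0,\dots,n-1$. A (diameter) perfect Sudoku grid is an $n\times n$ Latin square over $[n]=\{1,\dots,n\}$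 orthogonal to the palette grid (the ordered pairs of corresponding entries are pairwise distinct). A Sudoku game is an $n\times n$ array in which some cells are filled with symbols from $[n]$ (hints) and the rest are blank; a solution is a grid in $\mathcal{S}$ agreeing with all hints. A minimal Sudoku for $S\in\mathcal{S}$ is a game whose unique solution is $S$ and such that removing any single hint yields a game without a unique solution. Maps on arrays (blank cells moved like entries, indices mod $n$): $(r(A))_{i,j}=A_{n-1-j,i}$, $(s(A))_{i,j}=A_{i,n-1-j}$, $(\tau_1(A))_{i,j}=A_{i-1,j}$, $(\tau_2(A))_{i,j}=A_{i,j-1}$; products denote composition. -}

module Defs where

open import Data.Nat using (ℕ; zero; suc; _+_; _*_; _∸_; _⊓_; _≤_)
open import Data.Nat.DivMod using (_mod_)
open import Data.Fin using (Fin; toℕ; opposite) renaming (_≟_ to _≟F_)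
open import Data.Bool using (Bool; true; false; not)
open import Data.Maybe using (Maybe; just; nothing)
open import Data.Product using (Σ; proj₁; proj₂; _×_; _,_; ∃; ∃-syntax; swap)
open import Data.Sum using (_⊎_)
open import Data.List using (List; []; _∷_; _++_; replicate; reverse; map)
open import Data.List.Membership.Propositional using (_∈_)
open import Relation.Binary.PropositionalEquality using (_≡_; _≢_)
open import Relation.Nullary using (¬_; yes; no)

-- Maps on arrays as words in the primitive maps r, s, τ₁, τ₂
-- (and their inverses).  A word [l₁, …, lₖ] denotes l₁ ∘ ⋯ ∘ lₖ.

data Prim : Set where
  Pr Ps Pτ₁ Pτ₂ : Prim

-- (p , false) is p itself, (p , true) is p⁻¹
Letter : Set
Letter = Prim × Bool

Word : Set
Word = List Letter

flipL : Letter → Letter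
flipL (p , b) = (p , not b)

inv : Word → Word
inv w = reverse (map flipL w)

r s τ₁ τ₂ : Word
r  = (Pr , false) ∷ []
s  = (Ps , false) ∷ []
τ₁ = (Pτ₁ , false) ∷ []
τ₂ = (Pτ₂ , false) ∷ []

pow : Word → ℕ → Word
pow w zero    = []
pow w (suc k) = w ++ pow w k

data InGroup (gens : List Word) : Word → Set where
  ε    : InGroup gens []
  _·_  : ∀ {w g} → InGroup gens w → g ∈ gens → InGroup gens (w ++ g)
  _·⁻_ : ∀ {w g} → InGroup gens w → g ∈ gens → InGroup gens (w ++ inv g)

module _ {m : ℕ} where

  N : ℕ
  N = suc m

  Zn : Set
  Zn = Fin N

  ι : ℕ → Zn
  ι k = k mod N

  _⊕_ : Zn → Zn → Zn
  a ⊕ b = (toℕ a + toℕ b) mod N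

  neg : Zn → Zn
  neg a = (N ∸ toℕ a) mod N

  _⊖_ : Zn → Zn → Zn
  a ⊖ b = a ⊕ neg b

  _⊛_ : Zn → Zn → Zn
  a ⊛ b = (toℕ a * toℕ b) mod N

  Point : Set
  Point = Zn × Zn

  _⊕P_ : Point → Point → Point
  (u₁ , u₂) ⊕P (v₁ , v₂) = (u₁ ⊕ v₁ , u₂ ⊕ v₂)

  _⊖P_ : Point → Point → Point
  (u₁ , u₂) ⊖P (v₁ , v₂) = (u₁ ⊖ v₁ , u₂ ⊖ v₂)

  _·P_ : Zn → Point → Point
  λ' ·P (u₁ , u₂) = (λ' ⊛ u₁ , λ' ⊛ u₂)

  leeZ : Zn → ℕ
  leeZ u = toℕ u ⊓ (N ∸ toℕ u)

  wtL : Point → ℕ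
  wtL (u₁ , u₂) = leeZ u₁ + leeZ u₂

  dL : Point → Point → ℕ
  dL u v = wtL (u ⊖P v)

  Code : Set₁
  Code = Point → Set

  Gen1 : Zn → Zn → Code
  Gen1 a b p = ∃[ l ] p ≡ (l ⊛ a , l ⊛ b)

  -- code generated by [[t+1, t+1], [0, 2(t+1)]]
  CodeI : ℕ → Code
  CodeI t p = ∃[ l ] ∃[ μ ]
    p ≡ (l ⊛ ι (suc t) , (l ⊛ ι (suc t)) ⊕ (μ ⊛ ι (2 * suc t)))

  CodeII : ℕ → Code
  CodeII t = Gen1 (ι 1) (ι (suc (2 * t)))

  IsLinear : Code → Set
  IsLinear C = (∀ u v → C u → C v → C (u ⊕P v)) × (∀ l u → C u → C (l ·P u))

  Equivalent : Code → Code → Set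
  Equivalent C D =
      (∀ p → (C p → D p) × (D p → C p))
    ⊎ (∀ p → (C p → D (swap p)) × (D (swap p) → C p))

  MinLeeDist : Code → ℕ → Set
  MinLeeDist C d =
      (∀ u v → C u → C v → u ≢ v → d ≤ dL u v)
    × (∃[ u ] ∃[ v ] (C u × C v × u ≢ v × dL u v ≡ d))

  BallsPartition : Code → ℕ → Set
  BallsPartition C t =
    ∀ p → ∃[ c ] (C c × dL p c ≤ t × (∀ c' → C c' → dL p c' ≤ t → c' ≡ c))

  Coset : Point → Code → Code
  Coset x C₀ p = C₀ (p ⊖P x)

  Enumerates : (Fin N → Point) → Code → Set
  Enumerates c C =
      (∀ k → C (c k))
    × (∀ p → C p → ∃[ k ] c k ≡ p)
    × (∀ k k' → c k ≡ c k' → k ≡ k')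

  Arr : Set → Set
  Arr A = Fin N → Fin N → A

  Grid : Set
  Grid = Arr Zn

  Game : Set
  Game = Arr (Maybe Zn)

  _≗₂_ : ∀ {A} → Arr A → Arr A → Set
  X ≗₂ Y = ∀ i j → X i j ≡ Y i j

  IsPalettePerfect : ℕ → (Fin N → Point) → Grid → Set
  IsPalettePerfect t c P = ∀ i j k → dL (i , j) (c k) ≤ t → P i j ≡ k

  IsPaletteDiam : ℕ → (Fin N → Point) → Grid → Set
  IsPaletteDiam t c P = ∀ i j k →
    (dL (i , j) (c k) ≤ t ⊎ dL (i , j) (c k ⊕P (ι 1 , ι 0)) ≤ t) → P i j ≡ k

  ExactlyOnce : (Fin N → Zn) → Zn → Set
  ExactlyOnce f k = ∃[ j ] (f j ≡ k × (∀ j' → f j' ≡ k → j' ≡ j))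

  IsLatin : Grid → Set
  IsLatin S = (∀ i k → ExactlyOnce (λ j → S i j) k)
            × (∀ j k → ExactlyOnce (λ i → S i j) k)

  Orthogonal : Grid → Grid → Set
  Orthogonal S P = ∀ i j i' j' → S i j ≡ S i' j' → P i j ≡ P i' j' →
                   (i ≡ i' × j ≡ j')

  IsSudoku : Grid → Grid → Set
  IsSudoku P S = IsLatin S × Orthogonal S P

  IsSolution : Grid → Game → Grid → Set
  IsSolution P G S = IsSudoku P S × (∀ i j k → G i j ≡ just k → S i j ≡ k)

  UniqueSolution : Grid → Game → Grid → Set
  UniqueSolution P G S =
    IsSolution P G S × (∀ S' → IsSolution P G S' → S' ≗₂ S)

  HasUniqueSolution : Grid → Game → Set
  HasUniqueSolution P G = ∃[ S ] UniqueSolution P G S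

  removeHint : Game → Fin N → Fin N → Game
  removeHint G i j i' j' with i' ≟F i | j' ≟F j
  ... | yes _ | yes _ = nothing
  ... | _     | _     = G i' j'

  IsMinimal : Grid → Grid → Game → Set
  IsMinimal P S G = UniqueSolution P G S
    × (∀ i j → (∃[ k ] G i j ≡ just k) → ¬ HasUniqueSolution P (removeHint G i j))

  actL : ∀ {A} → Letter → Arr A → Arr A
  actL (Pr , false)  X i j = X (opposite j) i
  actL (Pr , true)   X i j = X j (opposite i)
  actL (Ps , false)  X i j = X i (opposite j)
  actL (Ps , true)   X i j = X i (opposite j)
  actL (Pτ₁ , false) X i j = X (i ⊖ ι 1) j
  actL (Pτ₁ , true)  X i j = X (i ⊕ ι 1) j
  actL (Pτ₂ , false) X i j = X i (j ⊖ ι 1)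
  actL (Pτ₂ , true)  X i j = X i (j ⊕ ι 1)

  act : ∀ {A} → Word → Arr A → Arr A
  act []      X = X
  act (l ∷ w) X = actL l (act w X)

  -- The three settings, each giving a palette grid P and generators of 𝒢_𝒮

  data Setting (P : Grid) : List Word → Set₁ where
    perfect : (t : ℕ) (a b : Zn) (x : Point) (c : Fin N → Point) →
      N ≡ 2 * t * t + 2 * t + 1 →
      MinLeeDist (Gen1 a b) (2 * t + 1) →
      BallsPartition (Gen1 a b) t →
      Enumerates c (Coset x (Gen1 a b)) →
      IsPalettePerfect t c P →
      Setting P
        ( (pow τ₂ (toℕ (proj₁ x) + toℕ (proj₂ x) + 1)
            ++ pow τ₁ (toℕ (proj₁ x) + (N ∸ toℕ (proj₂ x)))
            ++ r)
        ∷ (pow τ₁ (toℕ a) ++ pow τ₂ (toℕ b))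
        ∷ [])
    diamI : (t : ℕ) (C₀ : Code) (x : Point) (c : Fin N → Point) →
      N ≡ 2 * (t + 1) * (t + 1) →
      IsLinear C₀ →
      MinLeeDist C₀ (2 * t + 2) →
      Equivalent C₀ (CodeI t) →
      Enumerates c (Coset x C₀) →
      IsPaletteDiam t c P →
      Setting P
        ( (pow τ₁ (t + 1) ++ pow τ₂ (t + 1))
        ∷ pow τ₂ (2 * (t + 1))
        ∷ (pow τ₂ (2 * toℕ (proj₂ x) + 1) ++ s)
        ∷ (pow τ₁ (2 * toℕ (proj₁ x) + 2)
            ++ pow τ₂ (2 * toℕ (proj₂ x) + 1) ++ pow r 2)
        ∷ [])
    diamII : (t : ℕ) (a b : Zn) (x : Point) (c : Fin N → Point) →
      N ≡ 2 * (t + 1) * (t + 1) →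
      MinLeeDist (Gen1 a b) (2 * t + 2) →
      Equivalent (Gen1 a b) (CodeII t) →
      Enumerates c (Coset x (Gen1 a b)) →
      IsPaletteDiam t c P →
      Setting P
        ( (pow τ₁ (toℕ a) ++ pow τ₂ (toℕ b))
        ∷ (pow τ₁ (2 * toℕ (proj₁ x) + 2)
            ++ pow τ₂ (2 * toℕ (proj₂ x) + 1) ++ pow r 2)
        ∷ [])

{-# OPTIONS --safe #-}
module Submission where

-- Every map on arrays pulls cells back along a bijection, and permutes Latin squares.  If the
-- bijection also permutes the colour classes of the palette grid, it carries orthogonal grids to
-- orthogonal grids, hence solutions to solutions and minimal Sudoku to minimal Sudoku.  So it
-- suffices that every generator maps tiles (balls or anticodes around codewords) into tiles.
--
-- Translations, reflections and half turns do so because the code is a subgroup (in Case I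
-- invariant under a reflection).  In the diameter case the tiles cover the grid because in the
-- coordinates u = y + z, v = y - z the anticode is a square of side 2(t + 1), while the code
-- contains vectors that reduce u and then v modulo 2(t + 1).  For the quarter turn in the
-- perfect case, consider the codewords nearest to (1 , t) and (t , 1): both lie on the line
-- u = 2t + 1, and since the determinant of two codewords vanishes modulo n they coincide, so one
-- of (t , t + 1), (t + 1 , t) is a codeword.  Its entries are units with squares adding up to 0,
-- which makes the code invariant under (u , v) ↦ (- v , u).

open import Defs
  renaming (_⊕_ to infixl 6 _⊕_; _⊖_ to infixl 6 _⊖_; _⊛_ to infixl 7 _⊛_)
open import Algebra.Bundles using (CommutativeRing)
import Algebra.Properties.AbelianGroup as AbelianGroupProperties
open import Algebra.Properties.CommutativeSemigroup using (interchange; x∙yz≈y∙xz)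
import Algebra.Solver.Ring as RingSolver
open import Algebra.Solver.Ring.AlmostCommutativeRing
  using (fromCommutativeRing; _-Raw-AlmostCommutative⟶_)
open import Algebra.Structures using (IsCommutativeRing)
open import Data.Bool using (true; false)
open import Data.Empty using (⊥; ⊥-elim)
open import Data.Fin using (Fin; toℕ; opposite; punchOut) renaming (_≟_ to _≟F_)
open import Data.Fin.Properties
  using (toℕ-fromℕ<; toℕ-injective; toℕ<n; toℕ≤pred[n]; opposite-prop; opposite-involutive;
         any?; injective⇒≤; punchOut-injective)
open import Data.Integer as ℤ using (ℤ; +_; -[1+_]; ∣_∣)
open import Data.Integer.DivMod using (_/ℕ_; _%ℕ_; a≡a%ℕn+[a/ℕn]*n; n%ℕd<d)
import Data.Integer.Properties as ℤₚ
open import Data.Integer.Solver using (module +-*-Solver)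
open import Data.List using (List; []; _∷_; _++_; map)
open import Data.List.Membership.Propositional using (_∈_)
open import Data.List.Properties using (unfold-reverse)
open import Data.List.Relation.Unary.Any using (here; there)
import Data.Maybe as Maybe
open import Data.Maybe using (just; nothing)
open import Data.Nat
open import Data.Nat.DivMod
open import Data.Nat.Properties
open import Data.Product using (∃-syntax; _×_; _,_; proj₁; proj₂; uncurry; swap; map₁; map₂)
open import Data.Sum using (_⊎_; inj₁; inj₂)
open import Level using (0ℓ)
open import Relation.Binary.PropositionalEquality
open import Relation.Nullary using (yes; no)
open import Relation.Nullary.Decidable using (dec⇒maybe)

-- Integer geometry of balls and anticodes

-- The left side is one of the four signed sums of `y` and `z`, chosen by their signs. Each bound
-- carries its slack as a natural number, so that callers can supply it by a ring identity.
∣∣+∣∣-≤ : ∀ t y z {a b c d} →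
  + t ≡ (y ℤ.+ z) ℤ.+ + a → + t ≡ ℤ.- (y ℤ.+ z) ℤ.+ + b →
  + t ≡ (y ℤ.- z) ℤ.+ + c → + t ≡ ℤ.- (y ℤ.- z) ℤ.+ + d →
  ∣ y ∣ + ∣ z ∣ ≤ t
∣∣+∣∣-≤ t y z {a} {b} {c} {d} y+z -y-z y-z z-y
  with ℤₚ.+∣i∣≡i⊎+∣i∣≡-i y | ℤₚ.+∣i∣≡i⊎+∣i∣≡-i z
... | inj₁ ey | inj₁ ez = ℤₚ.drop‿+≤+ (subst₂ ℤ._≤_
  (sym (cong₂ ℤ._+_ ey ez)) (sym y+z) (ℤₚ.i≤i+j _ (+ a)))
... | inj₁ ey | inj₂ ez = ℤₚ.drop‿+≤+ (subst₂ ℤ._≤_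
  (sym (cong₂ ℤ._+_ ey ez)) (sym y-z) (ℤₚ.i≤i+j _ (+ c)))
... | inj₂ ey | inj₁ ez = ℤₚ.drop‿+≤+ (subst₂ ℤ._≤_
  (trans (solve 2 (λ y z → :- (y :- z) := :- y :+ z) refl y z) (sym (cong₂ ℤ._+_ ey ez)))
  (sym z-y) (ℤₚ.i≤i+j _ (+ d)))
  where open +-*-Solver
... | inj₂ ey | inj₂ ez = ℤₚ.drop‿+≤+ (subst₂ ℤ._≤_
  (trans (ℤₚ.neg-distrib-+ y z) (sym (cong₂ ℤ._+_ ey ez))) (sym -y-z) (ℤₚ.i≤i+j _ (+ b)))

InAnticode : ℕ → ℤ → ℤ → Set
InAnticode t y z = ∣ y ∣ + ∣ z ∣ ≤ t ⊎ ∣ y ℤ.- + 1 ∣ + ∣ z ∣ ≤ t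

-- The reflection of the range from 0 to 2t + 1; it turns the distance from the lower side of the
-- square into the slack to the upper side.
excess : ∀ t {a} → a < 2 * suc t → ∃[ a' ] + a' ≡ + t ℤ.+ + t ℤ.+ + 1 ℤ.- + a
excess t {a} a< with m≤n⇒∃[o]m+o≡n a<
... | a' , eq = a' , (begin
    + a'
      ≡⟨ solve 2 (λ a a' → a' := con (+ 1) :+ a :+ a' :- con (+ 1) :- a) refl (+ a) (+ a') ⟩
    + (suc a + a') ℤ.- + 1 ℤ.- + a    ≡⟨ cong (λ n → + n ℤ.- + 1 ℤ.- + a) eq ⟩
    + (2 * suc t) ℤ.- + 1 ℤ.- + a     ≡⟨ cong (λ n → n ℤ.- + 1 ℤ.- + a) (ℤₚ.pos-* 2 (suc t)) ⟩
    + 2 ℤ.* (+ 1 ℤ.+ + t) ℤ.- + 1 ℤ.- + a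
      ≡⟨ solve 2 (λ t a → con (+ 2) :* (con (+ 1) :+ t) :- con (+ 1) :- a := t :+ t :+ con (+ 1) :- a) refl (+ t) (+ a) ⟩
    + t ℤ.+ + t ℤ.+ + 1 ℤ.- + a       ∎)
  where
  open +-*-Solver
  open ≡-Reasoning

-- For y = - k the lower sides - t ≤ y ± z of the square suffice: they bound - y ± z by t, and y ± z
-- is smaller than - y ± z by 2k, whence the summand `k + k` in the slacks.
lower : ∀ t k z {a b} → + a ≡ ℤ.- (+ k) ℤ.+ z ℤ.+ + t → + b ≡ ℤ.- (+ k) ℤ.- z ℤ.+ + t →
  ∣ ℤ.- (+ k) ∣ + ∣ z ∣ ≤ t
lower t k z {a} {b} ea eb = ∣∣+∣∣-≤ t (ℤ.- (+ k)) z {b + (k + k)} {a} {a + (k + k)} {b}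
  (trans (solve 3 (λ k z t → t := (:- k :+ z) :+ ((:- k :- z :+ t) :+ (k :+ k))) refl (+ k) z (+ t))
    (cong (λ b → ℤ.- (+ k) ℤ.+ z ℤ.+ (b ℤ.+ (+ k ℤ.+ + k))) (sym eb)))
  (trans (solve 3 (λ k z t → t := :- (:- k :+ z) :+ (:- k :+ z :+ t)) refl (+ k) z (+ t))
    (cong (ℤ._+_ (ℤ.- (ℤ.- (+ k) ℤ.+ z))) (sym ea)))
  (trans (solve 3 (λ k z t → t := (:- k :- z) :+ ((:- k :+ z :+ t) :+ (k :+ k))) refl (+ k) z (+ t))
    (cong (λ a → ℤ.- (+ k) ℤ.- z ℤ.+ (a ℤ.+ (+ k ℤ.+ + k))) (sym ea)))
  (trans (solve 3 (λ k z t → t := :- (:- k :- z) :+ (:- k :- z :+ t)) refl (+ k) z (+ t))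
    (cong (ℤ._+_ (ℤ.- (ℤ.- (+ k) ℤ.- z))) (sym eb)))
  where open +-*-Solver

-- In the coordinates y + z and y - z the anticode is the square [-t, t+1]².
square⇒anticode : ∀ t y z {a b} → a < 2 * suc t → b < 2 * suc t →
  + a ≡ y ℤ.+ z ℤ.+ + t → + b ≡ y ℤ.- z ℤ.+ + t → InAnticode t y z
-- For y > 0 the centre is (1 , 0): the upper sides y ± z ≤ t + 1 give k ± z ≤ t with k = y - 1 ≥ 0,
-- and changing the sign of k only adds 2k to the slack. For y ≤ 0 the centre is the origin.
square⇒anticode t (+ suc k) z {a} {b} a< b< ea eb with excess t {a} a< | excess t {b} b<
... | a' , ea' | b' , eb' = inj₂ (∣∣+∣∣-≤ t (+ k) z {a'} {k + k + b'} {b'} {k + k + a'}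
    (lemma₁ (+ k) z (+ t) ea ea') (lemma₂ (+ k) z (+ t) eb eb')
    (lemma₃ (+ k) z (+ t) eb eb') (lemma₄ (+ k) z (+ t) ea ea'))
  where
  open +-*-Solver
  lemma₁ : ∀ k z t {a a'} → a ≡ + 1 ℤ.+ k ℤ.+ z ℤ.+ t → a' ≡ t ℤ.+ t ℤ.+ + 1 ℤ.- a →
    t ≡ k ℤ.+ z ℤ.+ a'
  lemma₁ k z t refl refl = solve 3 (λ k z t →
    t := k :+ z :+ (t :+ t :+ con (+ 1) :- (con (+ 1) :+ k :+ z :+ t))) refl k z t
  lemma₂ : ∀ k z t {b b'} → b ≡ + 1 ℤ.+ k ℤ.- z ℤ.+ t → b' ≡ t ℤ.+ t ℤ.+ + 1 ℤ.- b →
    t ≡ ℤ.- (k ℤ.+ z) ℤ.+ (k ℤ.+ k ℤ.+ b')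
  lemma₂ k z t refl refl = solve 3 (λ k z t →
    t := :- (k :+ z) :+ (k :+ k :+ (t :+ t :+ con (+ 1) :- (con (+ 1) :+ k :- z :+ t)))) refl k z t
  lemma₃ : ∀ k z t {b b'} → b ≡ + 1 ℤ.+ k ℤ.- z ℤ.+ t → b' ≡ t ℤ.+ t ℤ.+ + 1 ℤ.- b →
    t ≡ k ℤ.- z ℤ.+ b'
  lemma₃ k z t refl refl = solve 3 (λ k z t →
    t := k :- z :+ (t :+ t :+ con (+ 1) :- (con (+ 1) :+ k :- z :+ t))) refl k z t
  lemma₄ : ∀ k z t {a a'} → a ≡ + 1 ℤ.+ k ℤ.+ z ℤ.+ t → a' ≡ t ℤ.+ t ℤ.+ + 1 ℤ.- a →
    t ≡ ℤ.- (k ℤ.- z) ℤ.+ (k ℤ.+ k ℤ.+ a')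
  lemma₄ k z t refl refl = solve 3 (λ k z t →
    t := :- (k :- z) :+ (k :+ k :+ (t :+ t :+ con (+ 1) :- (con (+ 1) :+ k :+ z :+ t)))) refl k z t
square⇒anticode t (+ zero) z {a} {b} a< b< ea eb = inj₁ (lower t 0 z ea eb)
square⇒anticode t -[1+ k ] z {a} {b} a< b< ea eb = inj₁ (lower t (suc k) z ea eb)

-- Integer coverings by anticodes

divide-by : ∀ z d .{{_ : NonZero d}} → ∃[ q ] ∃[ a ] (a < d × + a ≡ z ℤ.- q ℤ.* + d)
divide-by z d = z /ℕ d , z %ℕ d , n%ℕd<d z d , (begin
    + (z %ℕ d)
      ≡⟨ solve 2 (λ r q → r := r :+ q :- q) refl (+ (z %ℕ d)) (z /ℕ d ℤ.* + d) ⟩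
    + (z %ℕ d) ℤ.+ z /ℕ d ℤ.* + d ℤ.- z /ℕ d ℤ.* + d
      ≡⟨ cong (ℤ._- z /ℕ d ℤ.* + d) (a≡a%ℕn+[a/ℕn]*n z d) ⟨
    z ℤ.- z /ℕ d ℤ.* + d                            ∎)
  where
  open +-*-Solver
  open ≡-Reasoning

-- `side` and `period` are the entries t + 1 and 2(t + 1) of the generator matrix in Case I, `slope`
-- is the entry 2t + 1 in Case II, and `area` is the modulus 2(t + 1)².
side period slope area : ℕ → ℤ
side t   = + 1 ℤ.+ + t
period t = + 2 ℤ.* side t
slope t  = + 1 ℤ.+ + 2 ℤ.* + t
area t   = period t ℤ.* side t

module _ (t : ℕ) (y z : ℤ) where

  private
    divide : ∀ x → ∃[ q ] ∃[ a ] (a < 2 * suc t × + a ≡ x ℤ.- q ℤ.* period t)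
    divide x with divide-by x (2 * suc t)
    ... | q , a , a< , eq = q , a , a< ,
      trans eq (cong (λ n → x ℤ.- q ℤ.* n) (ℤₚ.pos-* 2 (suc t)))

    open +-*-Solver

  -- With g = t + 1 and d = 2g, the codeword (l g , l g + μ d) has coordinate sum (l + μ) d and
  -- difference - μ d. The quotients q and q' of the shifted sum and difference therefore determine
  -- μ = - q' and l = q + q'.
  coverI : ∃[ l ] ∃[ μ ] InAnticode t (y ℤ.- l ℤ.* side t) (z ℤ.- (l ℤ.* side t ℤ.+ μ ℤ.* period t))
  coverI with divide (y ℤ.+ z ℤ.+ + t) | divide (y ℤ.- z ℤ.+ + t)
  ... | q , a , a< , ea | q' , b , b< , eb =
    q ℤ.+ q' , ℤ.- q' , square⇒anticode t
      (y ℤ.- (q ℤ.+ q') ℤ.* side t)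
      (z ℤ.- ((q ℤ.+ q') ℤ.* side t ℤ.+ ℤ.- q' ℤ.* period t)) a< b<
      (trans ea (solve 5 (λ y z t q q' →
        let g = con (+ 1) :+ t; d = con (+ 2) :* g; l = q :+ q'; μ = :- q' in
        y :+ z :+ t :- q :* d := (y :- l :* g) :+ (z :- (l :* g :+ μ :* d)) :+ t) refl y z (+ t) q q'))
      (trans eb (solve 5 (λ y z t q q' →
        let g = con (+ 1) :+ t; d = con (+ 2) :* g; l = q :+ q'; μ = :- q' in
        y :- z :+ t :- q' :* d := (y :- l :* g) :- (z :- (l :* g :+ μ :* d)) :+ t) refl y z (+ t) q q'))

  -- The vector (1 , 2t + 1) has coordinate sum 2(t + 1) and difference - 2t. Its multiple by t + 1
  -- is congruent to (t + 1 , - (t + 1)), with sum 0 and difference 2(t + 1). So q reduces the sum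
  -- first, and k then reduces the difference as altered by q.
  coverII : ∃[ l ] ∃[ k ] InAnticode t (y ℤ.- l)
    (z ℤ.- l ℤ.* slope t ℤ.+ k ℤ.* area t)
  coverII with divide (y ℤ.+ z ℤ.+ + t)
  ... | q , a , a< , ea with divide (y ℤ.- z ℤ.+ + 2 ℤ.* + t ℤ.* q ℤ.+ + t)
  ... | k , b , b< , eb =
    q ℤ.+ side t ℤ.* k , k , square⇒anticode t
      (y ℤ.- (q ℤ.+ side t ℤ.* k))
      (z ℤ.- (q ℤ.+ side t ℤ.* k) ℤ.* slope t ℤ.+ k ℤ.* area t) a< b<
      (trans ea (solve 5 (λ y z t q k →
        let g = con (+ 1) :+ t; d = con (+ 2) :* g; l = q :+ g :* k in
        y :+ z :+ t :- q :* d :=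
        (y :- l) :+ (z :- l :* (con (+ 1) :+ con (+ 2) :* t) :+ k :* (d :* g)) :+ t) refl y z (+ t) q k))
      (trans eb (solve 5 (λ y z t q k →
        let g = con (+ 1) :+ t; d = con (+ 2) :* g; l = q :+ g :* k in
        y :- z :+ con (+ 2) :* t :* q :+ t :- k :* d :=
        (y :- l) :- (z :- l :* (con (+ 1) :+ con (+ 2) :* t) :+ k :* (d :* g)) :+ t) refl y z (+ t) q k))

  -- Exchanging coordinates keeps sums and negates differences, so the term 2tq and the multiples of
  -- k in the codeword change sign compared with `coverII`.
  coverII-swap : ∃[ l ] ∃[ k ] InAnticode t
    (y ℤ.- l ℤ.* slope t ℤ.+ k ℤ.* area t) (z ℤ.- l)
  coverII-swap with divide (y ℤ.+ z ℤ.+ + t)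
  ... | q , a , a< , ea with divide (y ℤ.- z ℤ.- + 2 ℤ.* + t ℤ.* q ℤ.+ + t)
  ... | k , b , b< , eb =
    q ℤ.- side t ℤ.* k , ℤ.- k , square⇒anticode t
      (y ℤ.- (q ℤ.- side t ℤ.* k) ℤ.* slope t ℤ.+ ℤ.- k ℤ.* area t)
      (z ℤ.- (q ℤ.- side t ℤ.* k)) a< b<
      (trans ea (solve 5 (λ y z t q k →
        let g = con (+ 1) :+ t; d = con (+ 2) :* g; l = q :- g :* k in
        y :+ z :+ t :- q :* d :=
        (y :- l :* (con (+ 1) :+ con (+ 2) :* t) :+ :- k :* (d :* g)) :+ (z :- l) :+ t) refl y z (+ t) q k))
      (trans eb (solve 5 (λ y z t q k →
        let g = con (+ 1) :+ t; d = con (+ 2) :* g; l = q :- g :* k in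
        y :- z :- con (+ 2) :* t :* q :+ t :- k :* d :=
        (y :- l :* (con (+ 1) :+ con (+ 2) :* t) :+ :- k :* (d :* g)) :- (z :- l) :+ t) refl y z (+ t) q k))

-- The triangle inequality is an equality when w ≤ 0; when w > 0 both numbers are positive and it
-- loses at least 2.
overshoot : ∀ p w → (∃[ α ] (∣ w ∣ ≡ α × + suc p ℤ.- w ≡ + (suc p + α)))
  ⊎ 2 + ∣ + suc p ℤ.- w ∣ ≤ suc p + ∣ w ∣
overshoot p (+ zero)  = inj₁ (0 , refl , refl)
overshoot p -[1+ k ]  = inj₁ (suc k , refl , refl)
overshoot p (+ suc k) = inj₂ (begin
    2 + ∣ suc p ℤ.⊖ suc k ∣  ≡⟨ cong (λ z → 2 + ∣ z ∣) (ℤₚ.[1+m]⊖[1+n]≡m⊖n p k) ⟩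
    2 + ∣ p ℤ.⊖ k ∣          ≤⟨ +-monoʳ-≤ 2 (≤-trans (ℤₚ.∣m⊝n∣≤m⊔n p k) (m⊔n≤m+n p k)) ⟩
    2 + (p + k)              ≡⟨ cong suc (+-suc p k) ⟨
    suc p + suc k            ∎)
  where open ≤-Reasoning

-- A codeword nearest to a point just outside the ball lies straight beyond that point.
beyond : ∀ {p p' t} w w' → suc p + suc p' ≡ suc t → ∣ w ∣ + ∣ w' ∣ ≤ t →
  2 * t + 1 ≤ ∣ + suc p ℤ.- w ∣ + ∣ + suc p' ℤ.- w' ∣ →
  ∃[ α ] ∃[ α' ] (α + α' ≡ t × + suc p ℤ.- w ≡ + (suc p + α) × + suc p' ℤ.- w' ≡ + (suc p' + α'))
beyond {p} {p'} {t} w w' p+p'≡ near far = go (overshoot p w) (overshoot p' w')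
  where
  open ≤-Reasoning
  Good : ℕ → ℤ → Set
  Good p w = ∃[ α ] (∣ w ∣ ≡ α × + suc p ℤ.- w ≡ + (suc p + α))
  Bad : ℕ → ℤ → Set
  Bad p w = 2 + ∣ + suc p ℤ.- w ∣ ≤ suc p + ∣ w ∣
  far' : suc t + t ≤ ∣ + suc p ℤ.- w ∣ + ∣ + suc p' ℤ.- w' ∣
  far' = ≤-trans (≤-reflexive (trans (+-comm 1 (t + t)) (cong (λ s → t + s + 1) (sym (+-identityʳ t))))) far
  -- The weights available add up to (t + 1) + t = 2t + 1, exactly the required distance, so a loss
  -- of 2 in one coordinate is already impossible.
  too-near : 2 + (∣ + suc p ℤ.- w ∣ + ∣ + suc p' ℤ.- w' ∣) ≤ suc p + ∣ w ∣ + (suc p' + ∣ w' ∣) → ⊥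
  too-near le = m+1+n≰m (suc t + t) {1} (begin
    suc t + t + 2                                        ≡⟨ +-comm (suc t + t) 2 ⟩
    2 + (suc t + t)                                      ≤⟨ +-monoʳ-≤ 2 far' ⟩
    2 + (∣ + suc p ℤ.- w ∣ + ∣ + suc p' ℤ.- w' ∣)          ≤⟨ le ⟩
    suc p + ∣ w ∣ + (suc p' + ∣ w' ∣)
      ≡⟨ interchange +-commutativeSemigroup (suc p) _ (suc p') _ ⟩
    suc p + suc p' + (∣ w ∣ + ∣ w' ∣)                      ≤⟨ +-mono-≤ (≤-reflexive p+p'≡) near ⟩
    suc t + t                                            ∎)
  go : Good p w ⊎ Bad p w → Good p' w' ⊎ Bad p' w' → _
  go (inj₂ bad) _ = ⊥-elim (too-near (+-mono-≤ bad (ℤₚ.∣i-j∣≤∣i∣+∣j∣ (+ suc p') w')))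
  go (inj₁ _) (inj₂ bad) = ⊥-elim (too-near (begin
    2 + (∣ + suc p ℤ.- w ∣ + ∣ + suc p' ℤ.- w' ∣)
      ≡⟨ x∙yz≈y∙xz +-commutativeSemigroup 2 (∣ + suc p ℤ.- w ∣) (∣ + suc p' ℤ.- w' ∣) ⟩
    ∣ + suc p ℤ.- w ∣ + (2 + ∣ + suc p' ℤ.- w' ∣)
      ≤⟨ +-mono-≤ (ℤₚ.∣i-j∣≤∣i∣+∣j∣ (+ suc p) w) bad ⟩
    suc p + ∣ w ∣ + (suc p' + ∣ w' ∣)                      ∎))
  go (inj₁ (α , eα , eq)) (inj₁ (α' , eα' , eq')) = α , α' ,
    -- `near` bounds α + α' from above, `far'` from below.
    ≤-antisym (subst₂ (λ x y → x + y ≤ t) eα eα' near) (+-cancelˡ-≤ (suc t) t (α + α') (begin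
      suc t + t                        ≤⟨ far' ⟩
      ∣ + suc p ℤ.- w ∣ + ∣ + suc p' ℤ.- w' ∣ ≡⟨ cong₂ (λ y z → ∣ y ∣ + ∣ z ∣) eq eq' ⟩
      suc p + α + (suc p' + α')        ≡⟨ interchange +-commutativeSemigroup (suc p) α (suc p') α' ⟩
      suc p + suc p' + (α + α')        ≡⟨ cong (_+ (α + α')) p+p'≡ ⟩
      suc t + (α + α')                 ∎)) , eq , eq'

-- Arithmetic modulo n

module Residues {m : ℕ} where

  toℕ-ι : ∀ k → toℕ (ι {m} k) ≡ k % suc m
  toℕ-ι k = toℕ-fromℕ< (m%n<n k (suc m))

  ι-≡ : ∀ j k → j % suc m ≡ k % suc m → ι {m} j ≡ ι k
  ι-≡ j k eq = toℕ-injective (trans (toℕ-ι j) (trans eq (sym (toℕ-ι k))))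

  toℕ-ι-< : ∀ {k} → k < suc m → toℕ (ι {m} k) ≡ k
  toℕ-ι-< {k} k<n = trans (toℕ-ι k) (m<n⇒m%n≡m k<n)

  ι-toℕ : ∀ u → ι {m} (toℕ u) ≡ u
  ι-toℕ u = toℕ-injective (toℕ-ι-< (toℕ<n u))

  ι-+ : ∀ j k → ι {m} (j + k) ≡ ι j ⊕ ι k
  ι-+ j k = ι-≡ (j + k) (toℕ (ι {m} j) + toℕ (ι {m} k)) (trans (%-distribˡ-+ j k (suc m))
    (sym (cong₂ (λ a b → (a + b) % suc m) (toℕ-ι j) (toℕ-ι k))))

  ι-* : ∀ j k → ι {m} (j * k) ≡ ι j ⊛ ι k
  ι-* j k = ι-≡ (j * k) (toℕ (ι {m} j) * toℕ (ι {m} k)) (trans (%-distribˡ-* j k (suc m))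
    (sym (cong₂ (λ a b → (a * b) % suc m) (toℕ-ι j) (toℕ-ι k))))

  ι-N : ι {m} (suc m) ≡ ι 0
  ι-N = ι-≡ (suc m) 0 (n%n≡0 (suc m))

  ⊕-comm : ∀ (u v : Zn {m}) → u ⊕ v ≡ v ⊕ u
  ⊕-comm u v = cong (ι {m}) (+-comm (toℕ u) (toℕ v))

  ⊛-comm : ∀ (u v : Zn {m}) → u ⊛ v ≡ v ⊛ u
  ⊛-comm u v = cong (ι {m}) (*-comm (toℕ u) (toℕ v))

  -- Strips one reduction from a nested sum, so that ring laws modulo n follow from those of natural
  -- numbers.
  ⊕-ιˡ : ∀ k (u : Zn {m}) → ι k ⊕ u ≡ ι (k + toℕ u)
  ⊕-ιˡ k u = trans (cong (_⊕_ {m} (ι k)) (sym (ι-toℕ u))) (sym (ι-+ k (toℕ u)))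

  ⊛-ιˡ : ∀ k (u : Zn {m}) → ι k ⊛ u ≡ ι (k * toℕ u)
  ⊛-ιˡ k u = trans (cong (_⊛_ {m} (ι k)) (sym (ι-toℕ u))) (sym (ι-* k (toℕ u)))

  ⊕-assoc : ∀ (u v w : Zn {m}) → (u ⊕ v) ⊕ w ≡ u ⊕ (v ⊕ w)
  ⊕-assoc u v w = begin
    (u ⊕ v) ⊕ w                     ≡⟨ ⊕-ιˡ (toℕ u + toℕ v) w ⟩
    ι (toℕ u + toℕ v + toℕ w)
      ≡⟨ cong (ι {m}) (trans (+-assoc (toℕ u) _ _) (+-comm (toℕ u) _)) ⟩
    ι (toℕ v + toℕ w + toℕ u)       ≡⟨ ⊕-ιˡ (toℕ v + toℕ w) u ⟨
    (v ⊕ w) ⊕ u                     ≡⟨ ⊕-comm (v ⊕ w) u ⟩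
    u ⊕ (v ⊕ w)                     ∎
    where open ≡-Reasoning

  ⊛-assoc : ∀ (u v w : Zn {m}) → (u ⊛ v) ⊛ w ≡ u ⊛ (v ⊛ w)
  ⊛-assoc u v w = begin
    (u ⊛ v) ⊛ w                     ≡⟨ ⊛-ιˡ (toℕ u * toℕ v) w ⟩
    ι (toℕ u * toℕ v * toℕ w)
      ≡⟨ cong (ι {m}) (trans (*-assoc (toℕ u) _ _) (*-comm (toℕ u) _)) ⟩
    ι (toℕ v * toℕ w * toℕ u)       ≡⟨ ⊛-ιˡ (toℕ v * toℕ w) u ⟨
    (v ⊛ w) ⊛ u                     ≡⟨ ⊛-comm (v ⊛ w) u ⟩
    u ⊛ (v ⊛ w)                     ∎
    where open ≡-Reasoning

  ⊕-identityˡ : ∀ (u : Zn {m}) → ι 0 ⊕ u ≡ u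
  ⊕-identityˡ u = trans (⊕-ιˡ 0 u) (ι-toℕ u)

  ⊛-identityˡ : ∀ (u : Zn {m}) → ι 1 ⊛ u ≡ u
  ⊛-identityˡ u = trans (⊛-ιˡ 1 u) (trans (cong (ι {m}) (*-identityˡ (toℕ u))) (ι-toℕ u))

  neg-inverseˡ : ∀ (u : Zn {m}) → neg u ⊕ u ≡ ι 0
  neg-inverseˡ u = trans (⊕-ιˡ (suc m ∸ toℕ u) u)
    (trans (cong (ι {m}) (m∸n+n≡m (<⇒≤ (toℕ<n u)))) ι-N)

  ⊛-distribʳ-⊕ : ∀ (w u v : Zn {m}) → (u ⊕ v) ⊛ w ≡ (u ⊛ w) ⊕ (v ⊛ w)
  ⊛-distribʳ-⊕ w u v = trans (⊛-ιˡ (toℕ u + toℕ v) w)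
    (trans (cong (ι {m}) (*-distribʳ-+ (toℕ w) (toℕ u) (toℕ v))) (ι-+ (toℕ u * toℕ w) (toℕ v * toℕ w)))

  ⊛-distribˡ-⊕ : ∀ (w u v : Zn {m}) → w ⊛ (u ⊕ v) ≡ (w ⊛ u) ⊕ (w ⊛ v)
  ⊛-distribˡ-⊕ w u v = trans (⊛-comm w (u ⊕ v))
    (trans (⊛-distribʳ-⊕ w u v) (cong₂ (_⊕_ {m}) (⊛-comm u w) (⊛-comm v w)))

  Zn-isCommutativeRing : IsCommutativeRing {A = Zn {m}} _≡_ _⊕_ _⊛_ neg (ι 0) (ι 1)
  Zn-isCommutativeRing = record
    { isRing = record
      { +-isAbelianGroup = record
        { isGroup = record
          { isMonoid = record
            { isSemigroup = record
              { isMagma = record { isEquivalence = isEquivalence ; ∙-cong = cong₂ (_⊕_ {m}) }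
              ; assoc = ⊕-assoc }
            ; identity = ⊕-identityˡ , λ u → trans (⊕-comm u (ι 0)) (⊕-identityˡ u) }
          ; inverse = neg-inverseˡ , λ u → trans (⊕-comm u (neg u)) (neg-inverseˡ u)
          ; ⁻¹-cong = cong (neg {m}) }
        ; comm = ⊕-comm }
      ; *-cong = cong₂ (_⊛_ {m})
      ; *-assoc = ⊛-assoc
      ; *-identity = ⊛-identityˡ , λ u → trans (⊛-comm u (ι 1)) (⊛-identityˡ u)
      ; distrib = ⊛-distribˡ-⊕ , ⊛-distribʳ-⊕ }
    ; *-comm = ⊛-comm }

  Zn-commutativeRing : CommutativeRing 0ℓ 0ℓ
  Zn-commutativeRing = record { isCommutativeRing = Zn-isCommutativeRing }

  open AbelianGroupProperties (CommutativeRing.+-abelianGroup Zn-commutativeRing) public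
    using (xyx⁻¹≈y)
    renaming (ε⁻¹≈ε to neg-0; ⁻¹-involutive to neg-involutive; ⁻¹-∙-comm to neg-⊕-comm;
              inverseˡ-unique to neg-unique)

  -- Reduction of integers modulo n

  fromℤ : ℤ → Zn {m}
  fromℤ (+ k)    = ι k
  fromℤ -[1+ k ] = neg (ι (suc k))

  fromℤ-neg : ∀ z → fromℤ (ℤ.- z) ≡ neg (fromℤ z)
  fromℤ-neg (+ zero)  = sym neg-0
  fromℤ-neg (+ suc k) = refl
  fromℤ-neg -[1+ k ]  = sym (neg-involutive (ι (suc k)))

  fromℤ-⊖ : ∀ j k → fromℤ (j ℤ.⊖ k) ≡ ι j ⊖ ι k
  fromℤ-⊖ j k with ≤-total k j
  ... | inj₁ k≤j = begin
    fromℤ (j ℤ.⊖ k)               ≡⟨ cong fromℤ (ℤₚ.⊖-≥ k≤j) ⟩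
    ι (j ∸ k)                     ≡⟨ xyx⁻¹≈y (ι k) (ι (j ∸ k)) ⟨
    (ι k ⊕ ι (j ∸ k)) ⊖ ι k       ≡⟨ cong (_⊖ ι k) (ι-+ k (j ∸ k)) ⟨
    ι (k + (j ∸ k)) ⊖ ι k         ≡⟨ cong (λ i → ι i ⊖ ι k) (m+[n∸m]≡n k≤j) ⟩
    ι j ⊖ ι k                     ∎
    where open ≡-Reasoning
  ... | inj₂ j≤k = begin
    fromℤ (j ℤ.⊖ k)               ≡⟨ cong fromℤ (ℤₚ.⊖-≤ j≤k) ⟩
    fromℤ (ℤ.- (+ (k ∸ j)))       ≡⟨ fromℤ-neg (+ (k ∸ j)) ⟩
    neg (ι (k ∸ j))               ≡⟨ xyx⁻¹≈y (ι j) _ ⟨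
    (ι j ⊕ neg (ι (k ∸ j))) ⊖ ι j ≡⟨ ⊕-assoc (ι j) _ _ ⟩
    ι j ⊕ (neg (ι (k ∸ j)) ⊖ ι j) ≡⟨ cong (ι j ⊕_) (neg-⊕-comm (ι (k ∸ j)) (ι j)) ⟩
    ι j ⊖ (ι (k ∸ j) ⊕ ι j)       ≡⟨ cong (ι j ⊖_) (ι-+ (k ∸ j) j) ⟨
    ι j ⊖ ι (k ∸ j + j)           ≡⟨ cong (λ i → ι j ⊖ ι i) (m∸n+n≡m j≤k) ⟩
    ι j ⊖ ι k                     ∎
    where open ≡-Reasoning

  fromℤ-+ : ∀ y z → fromℤ (y ℤ.+ z) ≡ fromℤ y ⊕ fromℤ z
  fromℤ-+ (+ j)    (+ k)    = ι-+ j k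
  fromℤ-+ (+ j)    -[1+ k ] = fromℤ-⊖ j (suc k)
  fromℤ-+ -[1+ j ] (+ k)    = trans (fromℤ-⊖ k (suc j)) (⊕-comm (ι k) _)
  fromℤ-+ -[1+ j ] -[1+ k ] = begin
    neg (ι (suc (suc (j + k))))         ≡⟨ cong (λ i → neg (ι i)) (cong suc (+-suc j k)) ⟨
    neg (ι (suc j + suc k))             ≡⟨ cong (neg {m}) (ι-+ (suc j) (suc k)) ⟩
    neg (ι (suc j) ⊕ ι (suc k))         ≡⟨ neg-⊕-comm (ι (suc j)) (ι (suc k)) ⟨
    neg (ι (suc j)) ⊕ neg (ι (suc k))   ∎
    where open ≡-Reasoning

  open import Algebra.Properties.Ring (CommutativeRing.ring Zn-commutativeRing)
    using (-‿distribˡ-*; -‿distribʳ-*)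

  fromℤ-*-+ : ∀ z k → fromℤ (z ℤ.* + k) ≡ fromℤ z ⊛ ι k
  fromℤ-*-+ (+ j)    k = trans (cong fromℤ (sym (ℤₚ.pos-* j k))) (ι-* j k)
  fromℤ-*-+ -[1+ j ] k = begin
    fromℤ (-[1+ j ] ℤ.* + k)       ≡⟨ cong fromℤ (ℤₚ.neg-distribˡ-* (+ suc j) (+ k)) ⟨
    fromℤ (ℤ.- (+ suc j ℤ.* + k))  ≡⟨ fromℤ-neg (+ suc j ℤ.* + k) ⟩
    neg (fromℤ (+ suc j ℤ.* + k))  ≡⟨ cong (neg {m}) (fromℤ-*-+ (+ suc j) k) ⟩
    neg (ι (suc j) ⊛ ι k)          ≡⟨ -‿distribˡ-* (ι (suc j)) (ι k) ⟩
    neg (ι (suc j)) ⊛ ι k          ∎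
    where open ≡-Reasoning

  fromℤ-* : ∀ y z → fromℤ (y ℤ.* z) ≡ fromℤ y ⊛ fromℤ z
  fromℤ-* y (+ k)    = fromℤ-*-+ y k
  fromℤ-* y -[1+ k ] = begin
    fromℤ (y ℤ.* -[1+ k ])         ≡⟨ cong fromℤ (ℤₚ.neg-distribʳ-* y (+ suc k)) ⟨
    fromℤ (ℤ.- (y ℤ.* + suc k))    ≡⟨ fromℤ-neg (y ℤ.* + suc k) ⟩
    neg (fromℤ (y ℤ.* + suc k))    ≡⟨ cong (neg {m}) (fromℤ-*-+ y (suc k)) ⟩
    neg (fromℤ y ⊛ ι (suc k))      ≡⟨ -‿distribʳ-* (fromℤ y) (ι (suc k)) ⟩
    fromℤ y ⊛ neg (ι (suc k))      ∎
    where open ≡-Reasoning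

  fromℤ-morphism : CommutativeRing.rawRing ℤₚ.+-*-commutativeRing
    -Raw-AlmostCommutative⟶ fromCommutativeRing Zn-commutativeRing
  fromℤ-morphism = record
    { ⟦_⟧ = fromℤ ; +-homo = fromℤ-+ ; *-homo = fromℤ-* ; -‿homo = fromℤ-neg
    ; 0-homo = refl ; 1-homo = refl }

  -- Integer coefficients, because those of Zn do not normalise for a variable modulus.
  open RingSolver (CommutativeRing.rawRing ℤₚ.+-*-commutativeRing)
    (fromCommutativeRing Zn-commutativeRing) fromℤ-morphism
    (λ y z → Maybe.map (cong fromℤ) (dec⇒maybe (y ℤₚ.≟ z))) public
    using (solve; _:=_; _:+_; _:*_; _:-_; :-_; con)

  -- `opposite u` represents m - u, and adding u + 1 gives m + 1 = n.
  opposite-≡ : ∀ u → opposite u ≡ neg (u ⊕ ι 1)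
  opposite-≡ u = neg-unique (opposite u) (u ⊕ ι 1) (begin
    opposite u ⊕ (u ⊕ ι 1)
      ≡⟨ cong₂ (_⊕_ {m}) (ι-toℕ (opposite u))
           (trans (ι-+ (toℕ u) 1) (cong (_⊕ ι 1) (ι-toℕ u))) ⟨
    ι (toℕ (opposite u)) ⊕ ι (toℕ u + 1) ≡⟨ ι-+ (toℕ (opposite u)) (toℕ u + 1) ⟨
    ι (toℕ (opposite u) + (toℕ u + 1))  ≡⟨ cong (λ k → ι (k + (toℕ u + 1))) (opposite-prop u) ⟩
    ι (m ∸ toℕ u + (toℕ u + 1))         ≡⟨ cong (ι {m}) (+-assoc (m ∸ toℕ u) (toℕ u) 1) ⟨
    ι (m ∸ toℕ u + toℕ u + 1)           ≡⟨ cong (λ k → ι (k + 1)) (m∸n+n≡m (toℕ≤pred[n] u)) ⟩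
    ι (m + 1)                           ≡⟨ cong (ι {m}) (+-comm m 1) ⟩
    ι (suc m)                           ≡⟨ ι-N ⟩
    ι 0                                 ∎)
    where open ≡-Reasoning


  -- Lee weights and integer representatives

  leeZ-neg : ∀ u → leeZ (neg u) ≡ leeZ {m} u
  leeZ-neg u with toℕ u in eq
  ... | zero  = cong (λ k → k ⊓ (suc m ∸ k)) (trans (toℕ-ι (suc m)) (n%n≡0 (suc m)))
  -- Negating a nonzero residue exchanges the two arguments of the minimum.
  ... | suc k = begin
    toℕ (ι {m} (m ∸ k)) ⊓ (suc m ∸ toℕ (ι {m} (m ∸ k)))
      ≡⟨ cong (λ j → j ⊓ (suc m ∸ j)) (toℕ-ι-< (s≤s (m∸n≤m m k))) ⟩
    (m ∸ k) ⊓ (suc m ∸ (m ∸ k))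
      ≡⟨ cong ((m ∸ k) ⊓_) (m∸[m∸n]≡n {suc m} {suc k} (subst (_≤ suc m) eq (<⇒≤ (toℕ<n u)))) ⟩
    (m ∸ k) ⊓ suc k                            ≡⟨ ⊓-comm (m ∸ k) (suc k) ⟩
    suc k ⊓ (m ∸ k)                            ∎
    where open ≡-Reasoning

  leeZ-ι-≤ : ∀ k → leeZ {m} (ι k) ≤ k
  leeZ-ι-≤ k = ≤-trans (m⊓n≤m _ _) (≤-trans (≤-reflexive (toℕ-ι k)) (m%n≤m k (suc m)))

  leeZ-fromℤ-≤ : ∀ z → leeZ {m} (fromℤ z) ≤ ∣ z ∣
  leeZ-fromℤ-≤ (+ k)    = leeZ-ι-≤ k
  leeZ-fromℤ-≤ -[1+ k ] = ≤-trans (≤-reflexive (leeZ-neg (ι (suc k)))) (leeZ-ι-≤ (suc k))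

  -- With `leeZ-fromℤ-≤` this makes the Lee weight the least absolute value of an integer
  -- representative, which lets distance arguments pass to the integers and back.
  leeZ-lift : ∀ u → ∃[ z ] (fromℤ z ≡ u × ∣ z ∣ ≡ leeZ {m} u)
  leeZ-lift u with ⊓-sel (toℕ u) (suc m ∸ toℕ u)
  ... | inj₁ eq = + toℕ u , ι-toℕ u , sym eq
  ... | inj₂ eq = ℤ.- (+ (suc m ∸ toℕ u)) ,
    trans (fromℤ-neg (+ (suc m ∸ toℕ u))) (neg-involutive u) ,
    trans (ℤₚ.∣-i∣≡∣i∣ (+ (suc m ∸ toℕ u))) (sym eq)

  leeZ-small : ∀ {k} → k + k ≤ suc m → k < suc m → leeZ {m} (ι k) ≡ k
  leeZ-small {k} 2k≤n k<n = trans (cong (λ j → j ⊓ (suc m ∸ j)) (toℕ-ι-< k<n))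
    (m≤n⇒m⊓n≡m (m+n≤o⇒m≤o∸n k 2k≤n))

-- The action of words on cells and on minimal Sudoku

module _ {m : ℕ} where

  open Residues {m}

  pullL : Letter → Point {m} → Point {m}
  pullL (Pr  , false) (i , j) = opposite j , i
  pullL (Pr  , true)  (i , j) = j , opposite i
  pullL (Ps  , false) (i , j) = i , opposite j
  pullL (Ps  , true)  (i , j) = i , opposite j
  pullL (Pτ₁ , false) (i , j) = i ⊖ ι 1 , j
  pullL (Pτ₁ , true)  (i , j) = i ⊕ ι 1 , j
  pullL (Pτ₂ , false) (i , j) = i , j ⊖ ι 1
  pullL (Pτ₂ , true)  (i , j) = i , j ⊕ ι 1

  -- The action on cells is contravariant: the first letter, outermost on arrays, is applied to the
  -- cell first.
  pull : Word → Point {m} → Point {m}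
  pull []      p = p
  pull (l ∷ w) p = pull w (pullL l p)

  actL-pull : ∀ {A} l (X : Arr {m} A) p → uncurry (actL l X) p ≡ uncurry X (pullL l p)
  actL-pull (Pr  , false) X p = refl
  actL-pull (Pr  , true)  X p = refl
  actL-pull (Ps  , false) X p = refl
  actL-pull (Ps  , true)  X p = refl
  actL-pull (Pτ₁ , false) X p = refl
  actL-pull (Pτ₁ , true)  X p = refl
  actL-pull (Pτ₂ , false) X p = refl
  actL-pull (Pτ₂ , true)  X p = refl

  act-pull : ∀ {A} w (X : Arr {m} A) p → uncurry (act w X) p ≡ uncurry X (pull w p)
  act-pull []      X p = refl
  act-pull (l ∷ w) X p = trans (actL-pull l (act w X) p) (act-pull w X (pullL l p))

  pull-++ : ∀ w w' p → pull (w ++ w') p ≡ pull w' (pull w p)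
  pull-++ []      w' p = refl
  pull-++ (l ∷ w) w' p = pull-++ w w' (pullL l p)

  ⊖1⊕1 : ∀ (u : Zn {m}) → u ⊖ ι 1 ⊕ ι 1 ≡ u
  ⊖1⊕1 = solve 1 (λ u → u :- con (+ 1) :+ con (+ 1) := u) refl

  ⊕1⊖1 : ∀ (u : Zn {m}) → u ⊕ ι 1 ⊖ ι 1 ≡ u
  ⊕1⊖1 = solve 1 (λ u → u :+ con (+ 1) :- con (+ 1) := u) refl

  pullL-flip : ∀ l p → pullL (flipL l) (pullL l p) ≡ p
  pullL-flip (Pr  , false) (i , j) = cong (i ,_) (opposite-involutive j)
  pullL-flip (Pr  , true)  (i , j) = cong (_, j) (opposite-involutive i)
  pullL-flip (Ps  , false) (i , j) = cong (i ,_) (opposite-involutive j)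
  pullL-flip (Ps  , true)  (i , j) = cong (i ,_) (opposite-involutive j)
  pullL-flip (Pτ₁ , false) (i , j) = cong (_, j) (⊖1⊕1 i)
  pullL-flip (Pτ₁ , true)  (i , j) = cong (_, j) (⊕1⊖1 i)
  pullL-flip (Pτ₂ , false) (i , j) = cong (i ,_) (⊖1⊕1 j)
  pullL-flip (Pτ₂ , true)  (i , j) = cong (i ,_) (⊕1⊖1 j)

  flipL-involutive : ∀ l → flipL (flipL l) ≡ l
  flipL-involutive (p , false) = refl
  flipL-involutive (p , true)  = refl

  pull-inv-∷ : ∀ l w p → pull (inv (l ∷ w)) p ≡ pullL (flipL l) (pull (inv w) p)
  pull-inv-∷ l w p = trans (cong (λ v → pull v p) (unfold-reverse (flipL l) (map flipL w)))
    (pull-++ (inv w) _ p)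

  pull-invˡ : ∀ w p → pull (inv w) (pull w p) ≡ p
  pull-invˡ []      p = refl
  pull-invˡ (l ∷ w) p = trans (pull-inv-∷ l w _)
    (trans (cong (pullL (flipL l)) (pull-invˡ w (pullL l p))) (pullL-flip l p))

  pull-invʳ : ∀ w p → pull w (pull (inv w) p) ≡ p
  pull-invʳ []      p = refl
  pull-invʳ (l ∷ w) p = trans (cong (λ q → pull w (pullL l q)) (pull-inv-∷ l w p))
    (trans (cong (pull w) (trans (cong (λ k → pullL k (pullL (flipL l) (pull (inv w) p)))
                                       (sym (flipL-involutive l)))
                                 (pullL-flip (flipL l) _)))
           (pull-invʳ w p))

  pull-injective : ∀ w {p q} → pull w p ≡ pull w q → p ≡ q
  pull-injective w {p} {q} eq =
    trans (sym (pull-invˡ w p)) (trans (cong (pull (inv w)) eq) (pull-invˡ w q))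

  act-inv : ∀ {A} w (X : Arr {m} A) → act (inv w) (act w X) ≗₂ X
  act-inv w X i j = trans (act-pull (inv w) (act w X) (i , j))
    (trans (act-pull w X (pull (inv w) (i , j))) (cong (uncurry X) (pull-invʳ w (i , j))))

  inv-act : ∀ {A} w (X : Arr {m} A) → act w (act (inv w) X) ≗₂ X
  inv-act w X i j = trans (act-pull w (act (inv w) X) (i , j))
    (trans (act-pull (inv w) X (pull w (i , j))) (cong (uncurry X) (pull-invˡ w (i , j))))

  act-cong : ∀ {A} w {X Y : Arr {m} A} → X ≗₂ Y → act w X ≗₂ act w Y
  act-cong w {X} {Y} X≗Y i j = trans (act-pull w X (i , j))
    (trans (X≗Y _ _) (sym (act-pull w Y (i , j))))

  exactlyOnce-∘ : ∀ {f : Fin (suc m) → Zn {m}} {k} (β γ : Fin (suc m) → Fin (suc m)) →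
    (∀ i → β (γ i) ≡ i) → (∀ i → γ (β i) ≡ i) →
    ExactlyOnce f k → ExactlyOnce (λ i → f (β i)) k
  exactlyOnce-∘ {f} β γ βγ γβ (j , fj≡k , unique) =
    γ j , trans (cong f (βγ j)) fj≡k ,
    λ i fβi≡k → trans (sym (γβ i)) (cong γ (unique (β i) fβi≡k))

  actL-latin : ∀ l {S : Grid {m}} → IsLatin S → IsLatin (actL l S)
  actL-latin (Pr  , false) (rows , cols) =
    (λ i k → exactlyOnce-∘ opposite opposite opposite-involutive opposite-involutive (cols i k)) ,
    (λ j k → rows (opposite j) k)
  actL-latin (Pr  , true)  (rows , cols) =
    (λ i k → cols (opposite i) k) ,
    (λ j k → exactlyOnce-∘ opposite opposite opposite-involutive opposite-involutive (rows j k))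
  actL-latin (Ps  , false) (rows , cols) =
    (λ i k → exactlyOnce-∘ opposite opposite opposite-involutive opposite-involutive (rows i k)) ,
    (λ j k → cols (opposite j) k)
  actL-latin (Ps  , true)  (rows , cols) =
    (λ i k → exactlyOnce-∘ opposite opposite opposite-involutive opposite-involutive (rows i k)) ,
    (λ j k → cols (opposite j) k)
  actL-latin (Pτ₁ , false) (rows , cols) =
    (λ i k → rows (i ⊖ ι 1) k) ,
    (λ j k → exactlyOnce-∘ (_⊖ ι 1) (_⊕ ι 1) ⊕1⊖1 ⊖1⊕1 (cols j k))
  actL-latin (Pτ₁ , true)  (rows , cols) =
    (λ i k → rows (i ⊕ ι 1) k) ,
    (λ j k → exactlyOnce-∘ (_⊕ ι 1) (_⊖ ι 1) ⊖1⊕1 ⊕1⊖1 (cols j k))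
  actL-latin (Pτ₂ , false) (rows , cols) =
    (λ i k → exactlyOnce-∘ (_⊖ ι 1) (_⊕ ι 1) ⊕1⊖1 ⊖1⊕1 (rows i k)) ,
    (λ j k → cols (j ⊖ ι 1) k)
  actL-latin (Pτ₂ , true)  (rows , cols) =
    (λ i k → exactlyOnce-∘ (_⊕ ι 1) (_⊖ ι 1) ⊖1⊕1 ⊕1⊖1 (rows i k)) ,
    (λ j k → cols (j ⊕ ι 1) k)

  act-latin : ∀ w {S : Grid {m}} → IsLatin S → IsLatin (act w S)
  act-latin []      latin = latin
  act-latin (l ∷ w) latin = actL-latin l (act-latin w latin)

  -- Words that permute the colour classes of the palette grid

  Preserves : Grid {m} → Word → Set
  Preserves P w = ∀ p q → uncurry P p ≡ uncurry P q → uncurry P (pull w p) ≡ uncurry P (pull w q)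

  -- Both directions are recorded so that the property passes to inverses, and hence from generators
  -- to the group.
  Respects : Grid {m} → Word → Set
  Respects P w = Preserves P w × Preserves P (inv w)

  preserves-++ : ∀ {P} w w' → Preserves P w → Preserves P w' → Preserves P (w ++ w')
  preserves-++ {P} w w' pw pw' p q eq = subst₂ (λ a b → uncurry P a ≡ uncurry P b)
    (sym (pull-++ w w' p)) (sym (pull-++ w w' q)) (pw' _ _ (pw p q eq))

  preserves-resp : ∀ {P} w w' → (∀ p → pull w p ≡ pull w' p) → Preserves P w → Preserves P w'
  preserves-resp {P} w w' w≗w' pw p q eq =
    subst₂ (λ a b → uncurry P a ≡ uncurry P b) (w≗w' p) (w≗w' q) (pw p q eq)

  pull-inv-++ : ∀ w w' p → pull (inv (w ++ w')) p ≡ pull (inv w) (pull (inv w') p)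
  pull-inv-++ w w' p = pull-injective (w ++ w') (begin
    pull (w ++ w') (pull (inv (w ++ w')) p)        ≡⟨ pull-invʳ (w ++ w') p ⟩
    p                                              ≡⟨ pull-invʳ w' p ⟨
    pull w' (pull (inv w') p)                      ≡⟨ cong (pull w') (pull-invʳ w _) ⟨
    pull w' (pull w (pull (inv w) (pull (inv w') p))) ≡⟨ pull-++ w w' _ ⟨
    pull (w ++ w') (pull (inv w) (pull (inv w') p)) ∎)
    where open ≡-Reasoning

  respects-++ : ∀ {P} w w' → Respects P w → Respects P w' → Respects P (w ++ w')
  respects-++ {P} w w' (pw , pw⁻) (pw' , pw'⁻) = preserves-++ w w' pw pw' ,
    preserves-resp (inv w' ++ inv w) (inv (w ++ w'))
      (λ p → trans (pull-++ (inv w') (inv w) p) (sym (pull-inv-++ w w' p)))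
      (preserves-++ (inv w') (inv w) pw'⁻ pw⁻)

  respects-inv : ∀ {P} w → Respects P w → Respects P (inv w)
  respects-inv {P} w (pw , pw⁻) = pw⁻ , preserves-resp w (inv (inv w))
    (λ p → pull-injective (inv w) (trans (pull-invˡ w p) (sym (pull-invʳ (inv w) p)))) pw

  group-respects : ∀ {P gens} → (∀ {g} → g ∈ gens → Respects P g) →
    ∀ {φ} → InGroup gens φ → Respects P φ
  group-respects gen ε = (λ _ _ eq → eq) , (λ _ _ eq → eq)
  group-respects gen (_·_ {w} {g} w∈ g∈)  =
    respects-++ w g (group-respects gen w∈) (gen g∈)
  group-respects gen (_·⁻_ {w} {g} w∈ g∈) =
    respects-++ w (inv g) (group-respects gen w∈) (respects-inv g (gen g∈))

  -- Transport of solutions and minimal Sudoku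

  sudoku-act : ∀ {P S} w → Respects P w → IsSudoku P S → IsSudoku P (act w S)
  sudoku-act {P} {S} w (pw , _) (latin , orth) = act-latin w latin , orth'
    where
    -- Two cells with equal symbols and colours are pulled back to two cells with equal symbols in
    -- `S` and, by `pw`, equal colours. Orthogonality of `S` identifies these, and `pull w` is
    -- injective.
    orth' : Orthogonal (act w S) P
    orth' i j i' j' eqS eqP
      with orth _ _ _ _
        (trans (sym (act-pull w S (i , j))) (trans eqS (act-pull w S (i' , j'))))
        (pw (i , j) (i' , j') eqP)
    ... | eq₁ , eq₂ with pull-injective w {i , j} {i' , j'} (cong₂ _,_ eq₁ eq₂)
    ... | refl = refl , refl

  solution-act : ∀ {P G S} w → Respects P w → IsSolution P G S →
    IsSolution P (act w G) (act w S)
  solution-act {G = G} {S} w rw (sud , fits) = sudoku-act w rw sud ,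
    λ i j k eq → trans (act-pull w S (i , j))
      (fits _ _ k (trans (sym (act-pull w G (i , j))) eq))

  exactlyOnce-cong : ∀ {f g : Fin (suc m) → Zn {m}} {k} → (∀ i → f i ≡ g i) →
    ExactlyOnce f k → ExactlyOnce g k
  exactlyOnce-cong f≗g (j , fj≡k , unique) =
    j , trans (sym (f≗g j)) fj≡k , λ i gi≡k → unique i (trans (f≗g i) gi≡k)

  -- Arrays are compared entrywise, so being a Sudoku grid, and likewise being a solution or a
  -- unique solution, has to be shown invariant under `≗₂`.
  sudoku-cong : ∀ {P S S'} → S ≗₂ S' → IsSudoku P S → IsSudoku P S'
  sudoku-cong S≗ ((rows , cols) , orth) =
    ((λ i k → exactlyOnce-cong (S≗ i) (rows i k)) ,
     (λ j k → exactlyOnce-cong (λ i → S≗ i j) (cols j k))) ,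
    λ i j i' j' eqS → orth i j i' j' (trans (S≗ i j) (trans eqS (sym (S≗ i' j'))))

  solution-cong : ∀ {P G G' S S'} → G ≗₂ G' → S ≗₂ S' → IsSolution P G S → IsSolution P G' S'
  solution-cong G≗ S≗ (sud , fits) = sudoku-cong S≗ sud ,
    λ i j k eq → trans (sym (S≗ i j)) (fits i j k (trans (G≗ i j) eq))

  unique-cong : ∀ {P G G' S S'} → G ≗₂ G' → S ≗₂ S' → UniqueSolution P G S → UniqueSolution P G' S'
  unique-cong G≗ S≗ (sol , unique) = solution-cong G≗ S≗ sol ,
    λ T sol' i j → trans
      (unique T (solution-cong (λ a b → sym (G≗ a b)) (λ a b → refl) sol') i j) (S≗ i j)

  -- A competing solution `T` is carried back by `inv w`, where uniqueness for `G` applies.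
  unique-act : ∀ {P G S} w → Respects P w → UniqueSolution P G S →
    UniqueSolution P (act w G) (act w S)
  unique-act {P} {G} {S} w rw (sol , unique) = solution-act w rw sol , λ T sol' i j →
    trans (sym (inv-act w T i j))
      (act-cong w (unique (act (inv w) T)
        (solution-cong (act-inv w G) (λ a b → refl)
          (solution-act (inv w) (respects-inv w rw) sol'))) i j)

  removeHint-here : ∀ (G : Game {m}) i j → removeHint G i j i j ≡ nothing
  removeHint-here G i j with i ≟F i | j ≟F j
  ... | yes _ | yes _  = refl
  ... | yes _ | no j≢j = ⊥-elim (j≢j refl)
  ... | no i≢i | _     = ⊥-elim (i≢i refl)

  removeHint-elsewhere : ∀ (G : Game {m}) i j i' j' → (i' , j') ≢ (i , j) →
    removeHint G i j i' j' ≡ G i' j'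
  removeHint-elsewhere G i j i' j' ≢ij with i' ≟F i | j' ≟F j
  ... | yes refl | yes refl = ⊥-elim (≢ij refl)
  ... | yes _ | no _ = refl
  ... | no _  | yes _ = refl
  ... | no _  | no _ = refl

  -- The entry of `act w G` in a cell comes from the pulled-back cell of `G`; injectivity of
  -- `pull w` ensures that only one cell is emptied.
  removeHint-act : ∀ w (G : Game {m}) i j →
    act w (uncurry (removeHint G) (pull w (i , j))) ≗₂ removeHint (act w G) i j
  removeHint-act w G i j i' j' with i' ≟F i | j' ≟F j
  ... | yes refl | yes refl =
    trans (act-pull w _ (i , j)) (removeHint-here G (proj₁ (pull w (i , j))) (proj₂ (pull w (i , j))))
  ... | yes _ | no j'≢j = trans (act-pull w _ (i' , j')) (trans
    (removeHint-elsewhere G _ _ _ _ λ eq → j'≢j (cong proj₂ (pull-injective w eq)))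
    (sym (act-pull w G (i' , j'))))
  ... | no i'≢i | yes _ = trans (act-pull w _ (i' , j')) (trans
    (removeHint-elsewhere G _ _ _ _ λ eq → i'≢i (cong proj₁ (pull-injective w eq)))
    (sym (act-pull w G (i' , j'))))
  ... | no i'≢i | no _ = trans (act-pull w _ (i' , j')) (trans
    (removeHint-elsewhere G _ _ _ _ λ eq → i'≢i (cong proj₁ (pull-injective w eq)))
    (sym (act-pull w G (i' , j'))))

  -- If removing a hint from `act w G` left a unique solution `T`, then `inv w` would carry it to a
  -- unique solution of `G` without the corresponding hint.
  minimal-act : ∀ {P S S' G} w → Respects P w → S' ≗₂ act w S →
    IsMinimal P S G → IsMinimal P S' (act w G)
  minimal-act {P} {S} {S'} {G} w rw S'≗ (unique , minimal) =
    unique-cong (λ _ _ → refl) (λ i j → sym (S'≗ i j)) (unique-act w rw unique) ,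
    λ { i j (k , eq) (T , T-unique) →
      minimal _ _ (k , trans (sym (act-pull w G (i , j))) eq)
        (act (inv w) T , unique-cong
          (λ a b → trans (act-cong (inv w) (λ c d → sym (removeHint-act w G i j c d)) a b)
                         (act-inv w _ a b))
          (λ _ _ → refl)
          (unique-act (inv w) (respects-inv w rw) T-unique)) }

  -- The three clauses express bijectivity up to entrywise equality; `inv φ` supplies both the
  -- cancellation and the preimages.
  transport : ∀ {P S₁ S₂} φ → Respects P φ → S₂ ≗₂ act φ S₁ →
      (∀ G → IsMinimal P S₁ G → IsMinimal P S₂ (act φ G))
    × (∀ G G' → IsMinimal P S₁ G → IsMinimal P S₁ G' →
         act φ G ≗₂ act φ G' → G ≗₂ G')
    × (∀ H → IsMinimal P S₂ H → ∃[ G ] (IsMinimal P S₁ G × act φ G ≗₂ H))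
  transport {P} {S₁} {S₂} φ rφ S₂≗ =
    (λ G → minimal-act φ rφ S₂≗) ,
    (λ G G' _ _ eq i j → trans (sym (act-inv φ G i j))
      (trans (act-cong (inv φ) eq i j) (act-inv φ G' i j))) ,
    (λ H min → act (inv φ) H ,
      minimal-act (inv φ) (respects-inv φ rφ)
        (λ i j → sym (trans (act-cong (inv φ) S₂≗ i j) (act-inv φ S₁ i j))) min ,
      inv-act φ H)

  -- From tiles to colour classes

  injective⇒surjective : ∀ (g : Fin (suc m) → Fin (suc m)) →
    (∀ {a b} → g a ≡ g b → a ≡ b) → ∀ y → ∃[ x ] g x ≡ y
  injective⇒surjective g inj y with any? (λ x → g x ≟F y)
  ... | yes found = found
  -- Punching out a missed value `y` would inject m + 1 elements into m.
  ... | no  none  = ⊥-elim (1+n≰n (injective⇒≤ {f = λ x → punchOut (y≢ x)}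
                      λ {a} {b} eq → inj (punchOut-injective (y≢ a) (y≢ b) eq)))
    where
    y≢ : ∀ x → y ≢ g x
    y≢ x y≡gx = none (x , sym y≡gx)

  -- A map sending tiles into tiles induces a surjection of the finite set of colours,
  -- which is therefore a bijection; so the inverse map sends tiles into tiles as well.
  tiles⇒respects : ∀ {P : Grid {m}} {c : Fin (suc m) → Point} {Tile : Point → Point → Set} →
    (∀ p → ∃[ k ] Tile p (c k)) → (∀ p k → Tile p (c k) → uncurry P p ≡ k) →
    (∀ k → Tile (c k) (c k)) →
    ∀ w → (∀ k → ∃[ k' ] ∀ p → Tile p (c k) → Tile (pull w p) (c k')) → Respects P w
  tiles⇒respects {P} {c} {Tile} cover paint centre w move = forth , back
    where
    f g : Fin (suc m) → Fin (suc m)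
    f k = proj₁ (move k)
    g k = uncurry P (pull (inv w) (c k))

    colour-pull : ∀ p → uncurry P (pull w p) ≡ f (uncurry P p)
    colour-pull p with cover p
    ... | k , p∈k = trans (paint _ _ (proj₂ (move k) p p∈k)) (cong f (sym (paint p k p∈k)))

    -- `g k` is the colour of the cell that `pull w` sends to the centre `c k`, whose own colour is
    -- `k`.
    f∘g : ∀ k → f (g k) ≡ k
    f∘g k = trans (sym (colour-pull _))
      (trans (cong (uncurry P) (pull-invʳ w (c k))) (paint _ _ (centre k)))

    -- As `f` inverts `g` on the left, `g` is injective and by finiteness surjective. Writing `a`
    -- and `b` as values of `g` then shows that `f` is injective.
    f-injective : ∀ {a b} → f a ≡ f b → a ≡ b
    f-injective {a} {b} eq
      with injective⇒surjective g (λ {x} {y} e → trans (sym (f∘g x)) (trans (cong f e) (f∘g y))) a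
         | injective⇒surjective g (λ {x} {y} e → trans (sym (f∘g x)) (trans (cong f e) (f∘g y))) b
    ... | x , refl | y , refl = cong g (trans (sym (f∘g x)) (trans eq (f∘g y)))

    forth : Preserves P w
    forth p q eq = trans (colour-pull p) (trans (cong f eq) (sym (colour-pull q)))

    back : Preserves P (inv w)
    back p q eq = f-injective (trans (sym (colour-pull _))
      (trans (cong (uncurry P) (pull-invʳ w p))
        (trans eq (trans (cong (uncurry P) (sym (pull-invʳ w q))) (colour-pull _)))))

  -- Tilings and their symmetries

  pull-pow-τ₁ : ∀ k (i j : Zn {m}) → pull (pow τ₁ k) (i , j) ≡ (i ⊖ ι k , j)
  pull-pow-τ₁ zero    i j = cong (_, j) (solve 1 (λ i → i := i :- con (+ 0)) refl i)
  pull-pow-τ₁ (suc k) i j = trans (pull-pow-τ₁ k (i ⊖ ι 1) j) (cong (_, j) (trans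
    (solve 2 (λ i k → i :- con (+ 1) :- k := i :- (con (+ 1) :+ k)) refl i (ι k))
    (cong (_⊖_ i) (sym (ι-+ 1 k)))))

  pull-pow-τ₂ : ∀ k (i j : Zn {m}) → pull (pow τ₂ k) (i , j) ≡ (i , j ⊖ ι k)
  pull-pow-τ₂ zero    i j = cong (i ,_) (solve 1 (λ j → j := j :- con (+ 0)) refl j)
  pull-pow-τ₂ (suc k) i j = trans (pull-pow-τ₂ k i (j ⊖ ι 1)) (cong (i ,_) (trans
    (solve 2 (λ j k → j :- con (+ 1) :- k := j :- (con (+ 1) :+ k)) refl j (ι k))
    (cong (_⊖_ j) (sym (ι-+ 1 k)))))

  pull-τ₁ : ∀ k w (i j : Zn {m}) → pull (pow τ₁ k ++ w) (i , j) ≡ pull w (i ⊖ ι k , j)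
  pull-τ₁ k w i j = trans (pull-++ (pow τ₁ k) w (i , j)) (cong (pull w) (pull-pow-τ₁ k i j))

  pull-τ₂ : ∀ k w (i j : Zn {m}) → pull (pow τ₂ k ++ w) (i , j) ≡ pull w (i , j ⊖ ι k)
  pull-τ₂ k w i j = trans (pull-++ (pow τ₂ k) w (i , j)) (cong (pull w) (pull-pow-τ₂ k i j))

  leeZ-shift : ∀ (a u v : Zn {m}) → leeZ ((u ⊖ a) ⊖ (v ⊖ a)) ≡ leeZ (u ⊖ v)
  leeZ-shift a u v = cong leeZ (solve 3 (λ a u v → (u :- a) :- (v :- a) := u :- v) refl a u v)

  leeZ-flip : ∀ (a u v : Zn {m}) → leeZ ((a ⊖ u) ⊖ (a ⊖ v)) ≡ leeZ (u ⊖ v)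
  leeZ-flip a u v = trans
    (cong leeZ (solve 3 (λ a u v → (a :- u) :- (a :- v) := :- (u :- v)) refl a u v))
    (leeZ-neg (u ⊖ v))

  Isometry : (Point {m} → Point {m}) → Set
  Isometry f = ∀ p q → dL (f p) (f q) ≡ dL p q

  dL-refl : ∀ (p : Point {m}) → dL p p ≡ 0
  dL-refl (i , j) = cong₂ (λ u v → leeZ u + leeZ v) (u⊖u i) (u⊖u j)
    where
    u⊖u : ∀ (u : Zn {m}) → u ⊖ u ≡ ι 0
    u⊖u = solve 1 (λ u → u :- u := con (+ 0)) refl

  shift-isometry : ∀ v → Isometry (_⊖P v)
  shift-isometry (a , b) (i , j) (i' , j') = cong₂ _+_ (leeZ-shift a i i') (leeZ-shift b j j')

  -- The tiles around the points of the coset are painted with their indices, cover the grid and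
  -- contain their centres. Disjointness is implicit: a cell in two tiles would carry two colours.
  Tiling : Grid {m} → (Point {m} → Point {m} → Set) → Code {m} → Point {m} → Set
  Tiling P Tile C₀ x = ∃[ c ] (Enumerates c (Coset x C₀)
    × (∀ p k → Tile p (c k) → uncurry P p ≡ k)
    × (∀ p → ∃[ q ] (C₀ (q ⊖P x) × Tile p q))
    × (∀ q → Tile q q))

  -- The form of `tiles⇒respects` that speaks of the points of the coset instead of their indices.
  respects : ∀ {P Tile C₀ x} → Tiling P Tile C₀ x → ∀ w →
    (∀ q → C₀ (q ⊖P x) → ∃[ q' ] (C₀ (q' ⊖P x) × (∀ p → Tile p q → Tile (pull w p) q'))) →
    Respects P w
  respects {P} {Tile} {C₀} {x} (c , (c∈C , c-onto , _) , paint , cover , centre) w move =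
    tiles⇒respects {P = P} {c} {Tile} cover' paint (λ k → centre (c k)) w move'
    where
    cover' : ∀ p → ∃[ k ] Tile p (c k)
    cover' p with cover p
    ... | q , q∈ , tile with c-onto q q∈
    ... | k , refl = k , tile
    move' : ∀ k → ∃[ k' ] ∀ p → Tile p (c k) → Tile (pull w p) (c k')
    move' k with move (c k) (c∈C k)
    ... | q' , q'∈ , tiles with c-onto q' q'∈
    ... | k' , refl = k' , tiles

  -- For a nonempty code this single closure condition is the subgroup property.
  Subtractive : Code {m} → Set
  Subtractive C = ∀ u v → C u → C v → C (u ⊖P v)

  respects-shift : ∀ {P Tile C₀ x} → Tiling P Tile C₀ x → Subtractive C₀ →
    (∀ {p q} v → Tile p q → Tile (p ⊖P v) (q ⊖P v)) →
    ∀ w v → C₀ v → (∀ p → pull w p ≡ p ⊖P v) → Respects P w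
  respects-shift {P} {Tile} {C₀} {x} tiling sub tile-shift w v v∈ pull-w =
    respects {P} {Tile} {C₀} {x} tiling w λ q q∈ → q ⊖P v ,
      subst C₀ (comm q v x) (sub (q ⊖P x) v q∈ v∈) ,
      λ p tile → subst (λ p' → Tile p' (q ⊖P v)) (sym (pull-w p)) (tile-shift v tile)
    where
    comm₁ : ∀ (q v x : Zn {m}) → (q ⊖ x) ⊖ v ≡ (q ⊖ v) ⊖ x
    comm₁ = solve 3 (λ q v x → (q :- x) :- v := (q :- v) :- x) refl
    comm : ∀ q v x → (q ⊖P x) ⊖P v ≡ (q ⊖P v) ⊖P x
    comm (q₁ , q₂) (v₁ , v₂) (x₁ , x₂) = cong₂ _,_ (comm₁ q₁ v₁ x₁) (comm₁ q₂ v₂ x₂)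

  -- Balls and anticodes as tiles

  Ball : ℕ → Point {m} → Point {m} → Set
  Ball t p q = dL p q ≤ t

  e₁ : Point {m}
  e₁ = ι 1 , ι 0

  Anticode : ℕ → Point {m} → Point {m} → Set
  Anticode t p q = dL p q ≤ t ⊎ dL p (q ⊕P e₁) ≤ t

  ball-isometry : ∀ {t} f → Isometry f → ∀ {p q} → Ball t p q → Ball t (f p) (f q)
  ball-isometry {t} f iso {p} {q} = subst (_≤ t) (sym (iso p q))

  anticode-isometry : ∀ {t} f → Isometry f → ∀ {p} q {q'} → f q ≡ q' → f (q ⊕P e₁) ≡ q' ⊕P e₁ →
    Anticode t p q → Anticode t (f p) q'
  anticode-isometry {t} f iso {p} q refl eq (inj₁ le) = inj₁ (ball-isometry f iso le)
  anticode-isometry {t} f iso {p} q refl eq (inj₂ le) =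
    inj₂ (subst (Ball t (f p)) eq (ball-isometry f iso le))

  -- An isometry may also exchange the two centres of an anticode, as half turns do.
  anticode-swap : ∀ {t} f → Isometry f → ∀ {p} q {q'} → f (q ⊕P e₁) ≡ q' → f q ≡ q' ⊕P e₁ →
    Anticode t p q → Anticode t (f p) q'
  anticode-swap {t} f iso {p} q refl eq (inj₁ le) =
    inj₂ (subst (Ball t (f p)) eq (ball-isometry f iso le))
  anticode-swap {t} f iso {p} q refl eq (inj₂ le) = inj₁ (ball-isometry f iso le)

  anticode-shift : ∀ {t p q} v → Anticode t p q → Anticode t (p ⊖P v) (q ⊖P v)
  anticode-shift {p = p} {q@(q₁ , q₂)} v@(a , b) =
    anticode-isometry (_⊖P v) (shift-isometry v) {p} q refl
    (cong₂ _,_ (comm q₁ (ι 1) a) (comm q₂ (ι 0) b))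
    where
    comm : ∀ (q e a : Zn {m}) → (q ⊕ e) ⊖ a ≡ (q ⊖ a) ⊕ e
    comm = solve 3 (λ q e a → (q :+ e) :- a := (q :- a) :+ e) refl

  dL-unshift : ∀ p q (x : Point {m}) → dL (p ⊖P x) q ≡ dL p (q ⊕P x)
  dL-unshift (p₁ , p₂) (q₁ , q₂) (x₁ , x₂) =
    cong₂ (λ u v → leeZ u + leeZ v) (shuffle p₁ q₁ x₁) (shuffle p₂ q₂ x₂)
    where
    shuffle : ∀ (p q x : Zn {m}) → (p ⊖ x) ⊖ q ≡ p ⊖ (q ⊕ x)
    shuffle = solve 3 (λ p q x → (p :- x) :- q := p :- (q :+ x)) refl

  anticode-unshift : ∀ {t p q} x → Anticode t (p ⊖P x) q → Anticode t p (q ⊕P x)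
  anticode-unshift {t} {p} {q} x (inj₁ le) = inj₁ (subst (_≤ t) (dL-unshift p q x) le)
  anticode-unshift {t} {p} {q@(q₁ , q₂)} x@(x₁ , x₂) (inj₂ le) = inj₂ (subst (_≤ t)
    (trans (dL-unshift p (q ⊕P e₁) x)
      (cong (dL p) (cong₂ _,_ (exchange q₁ (ι 1) x₁) (exchange q₂ (ι 0) x₂)))) le)
    where
    exchange : ∀ (q e x : Zn {m}) → q ⊕ e ⊕ x ≡ q ⊕ x ⊕ e
    exchange = solve 3 (λ q e x → q :+ e :+ x := q :+ x :+ e) refl

  ⊕P-⊖P : ∀ (c x : Point {m}) → (c ⊕P x) ⊖P x ≡ c
  ⊕P-⊖P (c₁ , c₂) (x₁ , x₂) = cong₂ _,_ (cancel c₁ x₁) (cancel c₂ x₂)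
    where
    cancel : ∀ (c x : Zn {m}) → (c ⊕ x) ⊖ x ≡ c
    cancel = solve 2 (λ c x → (c :+ x) :- x := c) refl

  fromℤ-- : ∀ y z → fromℤ (y ℤ.- z) ≡ fromℤ y ⊖ fromℤ z
  fromℤ-- y z = trans (fromℤ-+ y (ℤ.- z)) (cong (_⊕_ (fromℤ y)) (fromℤ-neg z))

  -- Reduction modulo n does not increase weights, so integer coverings descend to residues.
  fromℤ-anticode : ∀ {t} p q y z → proj₁ p ⊖ proj₁ q ≡ fromℤ y → proj₂ p ⊖ proj₂ q ≡ fromℤ z →
    InAnticode t y z → Anticode t p q
  fromℤ-anticode {t} (p₁ , p₂) (q₁ , q₂) y z ey ez (inj₁ le) = inj₁ (≤-trans (+-mono-≤
    (subst (λ u → leeZ u ≤ ∣ y ∣) (sym ey) (leeZ-fromℤ-≤ y))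
    (subst (λ u → leeZ u ≤ ∣ z ∣) (sym ez) (leeZ-fromℤ-≤ z))) le)
  fromℤ-anticode {t} (p₁ , p₂) (q₁ , q₂) y z ey ez (inj₂ le) = inj₂ (≤-trans (+-mono-≤
    (subst (λ u → leeZ u ≤ ∣ y ℤ.- + 1 ∣)
      (trans (fromℤ-- y (+ 1)) (trans (cong (_⊖ ι 1) (sym ey))
        (solve 3 (λ p q e → p :- q :- e := p :- (q :+ e)) refl p₁ q₁ (ι 1))))
      (leeZ-fromℤ-≤ (y ℤ.- + 1)))
    (subst (λ u → leeZ u ≤ ∣ z ∣)
      (trans (sym ez) (solve 2 (λ p q → p :- q := p :- (q :+ con (+ 0))) refl p₂ q₂))
      (leeZ-fromℤ-≤ z))) le)

  diam-tiling : ∀ {P t C₀ x c} → Enumerates c (Coset x C₀) → IsPaletteDiam t c P →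
    (∀ z → ∃[ q ] (C₀ q × Anticode t z q)) → Tiling P (Anticode t) C₀ x
  diam-tiling {P} {t} {C₀} {x} {c} enum palette cover =
    c , enum , (λ { (i , j) → palette i j }) , cover' ,
    λ q → inj₁ (≤-trans (≤-reflexive (dL-refl q)) z≤n)
    where
    cover' : ∀ p → ∃[ q ] (C₀ (q ⊖P x) × Anticode t p q)
    cover' p with cover (p ⊖P x)
    ... | q , q∈ , near = q ⊕P x , subst C₀ (sym (⊕P-⊖P q x)) q∈ , anticode-unshift {p = p} {q} x near

  -- Half turns and reflections of anticodes

  ι-2*+ : ∀ (x : Zn {m}) k → ι (2 * toℕ x + k) ≡ x ⊕ x ⊕ ι k
  ι-2*+ x k = begin
    ι (2 * toℕ x + k)          ≡⟨ ι-+ (2 * toℕ x) k ⟩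
    ι (2 * toℕ x) ⊕ ι k        ≡⟨ cong (_⊕ ι k) (ι-* 2 (toℕ x)) ⟩
    ι 2 ⊛ ι (toℕ x) ⊕ ι k      ≡⟨ cong (λ u → ι 2 ⊛ u ⊕ ι k) (ι-toℕ x) ⟩
    ι 2 ⊛ x ⊕ ι k
      ≡⟨ solve 2 (λ x k → con (+ 2) :* x :+ k := x :+ x :+ k) refl x (ι k) ⟩
    x ⊕ x ⊕ ι k                ∎
    where open ≡-Reasoning

  -- Since `opposite` is v ↦ - (v + 1), the reflection u ↦ k - u needs a translation by k + 1. This
  -- accounts for the odd summand in the exponents of the generators.
  opposite-⊖ : ∀ (u k : Zn {m}) → opposite (u ⊖ (k ⊕ ι 1)) ≡ k ⊖ u
  opposite-⊖ u k = trans (opposite-≡ (u ⊖ (k ⊕ ι 1)))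
    (solve 2 (λ u k → :- (u :- (k :+ con (+ 1)) :+ con (+ 1)) := k :- u) refl u k)

  halfturn : Point {m} → Word
  halfturn (x₁ , x₂) = pow τ₁ (2 * toℕ x₁ + 2) ++ pow τ₂ (2 * toℕ x₂ + 1) ++ pow r 2

  -- The first coordinate is reflected so that x₁ and x₁ + 1 are exchanged, the second so that x₂ is
  -- fixed.
  pull-halfturn : ∀ (x₁ x₂ i j : Zn {m}) →
    pull (halfturn (x₁ , x₂)) (i , j) ≡ (x₁ ⊕ x₁ ⊕ ι 1 ⊖ i , x₂ ⊕ x₂ ⊖ j)
  pull-halfturn x₁ x₂ i j = trans (pull-τ₁ (2 * toℕ x₁ + 2) _ i j)
    (trans (pull-τ₂ (2 * toℕ x₂ + 1) (pow r 2) _ j) (cong₂ _,_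
      (trans (cong (λ k → opposite (i ⊖ k)) (trans (ι-2*+ x₁ 2)
          (solve 1 (λ x → x :+ x :+ con (+ 2) := x :+ x :+ con (+ 1) :+ con (+ 1)) refl x₁)))
        (opposite-⊖ i (x₁ ⊕ x₁ ⊕ ι 1)))
      (trans (cong (λ k → opposite (j ⊖ k)) (ι-2*+ x₂ 1)) (opposite-⊖ j (x₂ ⊕ x₂)))))

  -- The two centres q and q + (1 , 0) are sent to q' + (1 , 0) and q' for q' = 2x - q, which lies
  -- in the coset because the code contains negatives.
  respects-halfturn : ∀ {P t C₀} x → Tiling P (Anticode t) C₀ x → Subtractive C₀ →
    Respects P (halfturn x)
  respects-halfturn {P} {t} {C₀} x@(x₁ , x₂) tiling sub =
    respects {P} {Anticode t} {C₀} {x} tiling (halfturn x) move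
    where
    f : Point {m} → Point {m}
    f (i , j) = x₁ ⊕ x₁ ⊕ ι 1 ⊖ i , x₂ ⊕ x₂ ⊖ j
    iso : Isometry f
    iso (i , j) (i' , j') = cong₂ _+_ (leeZ-flip (x₁ ⊕ x₁ ⊕ ι 1) i i') (leeZ-flip (x₂ ⊕ x₂) j j')
    reflect : ∀ (q x : Zn {m}) → ((q ⊖ x) ⊖ (q ⊖ x)) ⊖ (q ⊖ x) ≡ (x ⊕ x ⊖ q) ⊖ x
    reflect = solve 2 (λ q x → ((q :- x) :- (q :- x)) :- (q :- x) := (x :+ x :- q) :- x) refl
    move : ∀ q → C₀ (q ⊖P x) → ∃[ q' ] (C₀ (q' ⊖P x)
      × (∀ p → Anticode t p q → Anticode t (pull (halfturn x) p) q'))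
    move q@(q₁ , q₂) q∈ = (x₁ ⊕ x₁ ⊖ q₁ , x₂ ⊕ x₂ ⊖ q₂) ,
      -- The negative of u = q - x is obtained from differences as (u - u) - u.
      subst C₀ (cong₂ _,_ (reflect q₁ x₁) (reflect q₂ x₂)) (sub (u ⊖P u) u (sub u u q∈ q∈) q∈) ,
      λ { p@(i , j) near → subst (λ p' → Anticode t p' (x₁ ⊕ x₁ ⊖ q₁ , x₂ ⊕ x₂ ⊖ q₂))
        (sym (pull-halfturn x₁ x₂ i j))
        (anticode-swap f iso {p} q
          (cong₂ _,_
            (solve 2 (λ x q → x :+ x :+ con (+ 1) :- (q :+ con (+ 1)) := x :+ x :- q) refl x₁ q₁)
            (solve 2 (λ x q → x :+ x :- (q :+ con (+ 0)) := x :+ x :- q) refl x₂ q₂))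
          (cong₂ _,_
            (solve 2 (λ x q → x :+ x :+ con (+ 1) :- q := x :+ x :- q :+ con (+ 1)) refl x₁ q₁)
            (solve 2 (λ x q → x :+ x :- q := x :+ x :- q :+ con (+ 0)) refl x₂ q₂))
          near) }
      where
      u : Point {m}
      u = q ⊖P x

  mirror : Zn {m} → Word
  mirror x₂ = pow τ₂ (2 * toℕ x₂ + 1) ++ s

  -- Only the second coordinate is reflected, so the two centres of an anticode keep their roles.
  respects-mirror : ∀ {P t C₀} x → Tiling P (Anticode t) C₀ x →
    (∀ u v → C₀ (u , v) → C₀ (u , neg v)) → Respects P (mirror (proj₂ x))
  respects-mirror {P} {t} {C₀} x@(x₁ , x₂) tiling symm =
    respects {P} {Anticode t} {C₀} {x} tiling (mirror x₂) move
    where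
    f : Point {m} → Point {m}
    f (i , j) = i , x₂ ⊕ x₂ ⊖ j
    iso : Isometry f
    iso (i , j) (i' , j') = cong₂ _+_ refl (leeZ-flip (x₂ ⊕ x₂) j j')
    pull-mirror : ∀ p → pull (mirror x₂) p ≡ f p
    pull-mirror (i , j) = trans (pull-τ₂ (2 * toℕ x₂ + 1) s i j) (cong (i ,_)
      (trans (cong (λ k → opposite (j ⊖ k)) (ι-2*+ x₂ 1)) (opposite-⊖ j (x₂ ⊕ x₂))))
    move : ∀ q → C₀ (q ⊖P x) → ∃[ q' ] (C₀ (q' ⊖P x)
      × (∀ p → Anticode t p q → Anticode t (pull (mirror x₂) p) q'))
    move q@(q₁ , q₂) q∈ = (q₁ , x₂ ⊕ x₂ ⊖ q₂) ,
      subst C₀ (cong (q₁ ⊖ x₁ ,_)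
        (solve 2 (λ q x → :- (q :- x) := x :+ x :- q :- x) refl q₂ x₂)) (symm (q₁ ⊖ x₁) (q₂ ⊖ x₂) q∈) ,
      λ { p near → subst (λ p' → Anticode t p' (q₁ , x₂ ⊕ x₂ ⊖ q₂)) (sym (pull-mirror p))
        (anticode-isometry f iso {p} q refl
          (cong (q₁ ⊕ ι 1 ,_)
            (solve 2 (λ x q → x :+ x :- (q :+ con (+ 0)) := x :+ x :- q :+ con (+ 0)) refl x₂ q₂))
          near) }

  -- The linear codes and their coverings

  gen1-subtractive : ∀ (a b : Zn {m}) → Subtractive (Gen1 a b)
  gen1-subtractive a b _ _ (l , refl) (l' , refl) = l ⊖ l' , cong₂ _,_ (distrib a) (distrib b)
    where
    distrib : ∀ a → l ⊛ a ⊖ l' ⊛ a ≡ (l ⊖ l') ⊛ a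
    distrib a = solve 3 (λ l l' a → l :* a :- l' :* a := (l :- l') :* a) refl l l' a

  gen1-generator : ∀ (a b : Zn {m}) → Gen1 a b (a , b)
  gen1-generator a b = ι 1 , cong₂ _,_ (sym (⊛-identityˡ a)) (sym (⊛-identityˡ b))

  pull-translation : ∀ k l (p : Point {m}) →
    pull (pow τ₁ k ++ pow τ₂ l) p ≡ p ⊖P (ι k , ι l)
  pull-translation k l (i , j) = trans (pull-τ₁ k (pow τ₂ l) i j) (pull-pow-τ₂ l _ j)

  pull-gen1 : ∀ (a b : Zn {m}) p → pull (pow τ₁ (toℕ a) ++ pow τ₂ (toℕ b)) p ≡ p ⊖P (a , b)
  pull-gen1 a b p = trans (pull-translation (toℕ a) (toℕ b) p)
    (cong₂ (λ u v → p ⊖P (u , v)) (ι-toℕ a) (ι-toℕ b))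

  codeI-subtractive : ∀ t → Subtractive (CodeI {m} t)
  codeI-subtractive t _ _ (l , μ , refl) (l' , μ' , refl) = l ⊖ l' , μ ⊖ μ' , cong₂ _,_
    (solve 3 (λ l l' g → l :* g :- l' :* g := (l :- l') :* g) refl l l' (ι (suc t)))
    (solve 6 (λ l l' μ μ' g d → l :* g :+ μ :* d :- (l' :* g :+ μ' :* d) :=
       (l :- l') :* g :+ (μ :- μ') :* d) refl l l' μ μ' (ι (suc t)) (ι (2 * suc t)))

  -- With g = t + 1 the codeword is (l g , (l + 2μ) g), so exchanging coordinates replaces l by l +
  -- 2μ and μ by - μ.
  codeI-swap : ∀ t {p} → CodeI {m} t p → CodeI t (swap p)
  codeI-swap t (l , μ , refl) = l ⊕ ι 2 ⊛ μ , neg μ , cong₂ _,_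
    (trans (cong (λ d → l ⊛ ι (suc t) ⊕ μ ⊛ d) (ι-* 2 (suc t)))
      (solve 3 (λ l μ g → l :* g :+ μ :* (con (+ 2) :* g) := (l :+ con (+ 2) :* μ) :* g)
        refl l μ (ι (suc t))))
    (trans (solve 3 (λ l μ g → l :* g :=
        (l :+ con (+ 2) :* μ) :* g :+ :- μ :* (con (+ 2) :* g)) refl l μ (ι (suc t)))
      (cong (λ d → (l ⊕ ι 2 ⊛ μ) ⊛ ι (suc t) ⊕ neg μ ⊛ d) (sym (ι-* 2 (suc t)))))

  -- With g = t + 1, the negated second entry is - (l + 2μ) g = l g + (- l - μ) 2g, which gives the
  -- new coefficient of the second row.
  codeI-mirror : ∀ t u v → CodeI {m} t (u , v) → CodeI t (u , neg v)
  codeI-mirror t _ _ (l , μ , refl) = l , neg l ⊖ μ , cong (l ⊛ ι (suc t) ,_)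
    (trans (cong (λ d → neg (l ⊛ ι (suc t) ⊕ μ ⊛ d)) (ι-* 2 (suc t)))
      (trans (solve 3 (λ l μ g → :- (l :* g :+ μ :* (con (+ 2) :* g)) :=
          l :* g :+ (:- l :- μ) :* (con (+ 2) :* g)) refl l μ (ι (suc t)))
        (cong (λ d → l ⊛ ι (suc t) ⊕ (neg l ⊖ μ) ⊛ d) (sym (ι-* 2 (suc t))))))

  codeI-cover : ∀ t z → ∃[ q ] (CodeI {m} t q × Anticode t z q)
  codeI-cover t z@(z₁ , z₂) = go (coverI t (+ toℕ z₁) (+ toℕ z₂))
    where
    q₁ : ℤ → Zn
    q₁ l = fromℤ l ⊛ ι (suc t)
    q₂ : ℤ → ℤ → Zn
    q₂ l μ = fromℤ l ⊛ ι (suc t) ⊕ fromℤ μ ⊛ ι (2 * suc t)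
    eq₁ : ∀ l → z₁ ⊖ q₁ l ≡ fromℤ (+ toℕ z₁ ℤ.- l ℤ.* side t)
    eq₁ l = sym (trans (fromℤ-- (+ toℕ z₁) (l ℤ.* side t))
      (cong₂ (_⊖_ {m}) (ι-toℕ z₁) (fromℤ-* l (side t))))
    eq₂ : ∀ l μ → z₂ ⊖ q₂ l μ ≡ fromℤ (+ toℕ z₂ ℤ.- (l ℤ.* side t ℤ.+ μ ℤ.* period t))
    eq₂ l μ = sym (trans (fromℤ-- (+ toℕ z₂) (l ℤ.* side t ℤ.+ μ ℤ.* period t))
      (cong₂ (_⊖_ {m}) (ι-toℕ z₂) (trans (fromℤ-+ (l ℤ.* side t) (μ ℤ.* period t))
        (cong₂ (_⊕_ {m}) (fromℤ-* l (side t)) (fromℤ-* μ (period t))))))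
    go : _ → ∃[ q ] (CodeI {m} t q × Anticode t z q)
    go (l , μ , near) = (q₁ l , q₂ l μ) , (fromℤ l , fromℤ μ , refl) ,
      fromℤ-anticode z (q₁ l , q₂ l μ)
        (+ toℕ z₁ ℤ.- l ℤ.* side t) (+ toℕ z₂ ℤ.- (l ℤ.* side t ℤ.+ μ ℤ.* period t))
        (eq₁ l) (eq₂ l μ) near

  -- The code of Case I is invariant under exchanging coordinates, so equivalence with it amounts to
  -- equality.
  equivalent-codeI : ∀ {t} {C₀ : Code {m}} → Equivalent C₀ (CodeI t) →
    ∀ p → (C₀ p → CodeI t p) × (CodeI t p → C₀ p)
  equivalent-codeI     (inj₁ same)    p = same p
  equivalent-codeI {t} (inj₂ swapped) p =
    (λ p∈ → codeI-swap t (proj₁ (swapped p) p∈)) , (λ p∈ → proj₂ (swapped p) (codeI-swap t p∈))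

  enumerates-cong : ∀ {c x} {C D : Code {m}} → (∀ p → (C p → D p) × (D p → C p)) →
    Enumerates c (Coset x C) → Enumerates c (Coset x D)
  enumerates-cong C⇔D (c∈ , onto , inj) =
    (λ k → proj₁ (C⇔D _) (c∈ k)) , (λ p p∈ → onto p (proj₂ (C⇔D _) p∈)) , inj

  -- Both orientations of the code are covered, one for each alternative of `Equivalent`.
  codeII-cover : ∀ t z → suc m ≡ 2 * (t + 1) * (t + 1) →
    (∃[ q ] (CodeII {m} t q × Anticode t z q)) × (∃[ q ] (CodeII {m} t (swap q) × Anticode t z q))
  codeII-cover t (z₁ , z₂) n≡ =
    direct (coverII t (+ toℕ z₁) (+ toℕ z₂)) , swapped (coverII-swap t (+ toℕ z₁) (+ toℕ z₂))
    where
    -- `area t` is the modulus, so the correction by its multiples disappears in the residues.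
    n≡0 : ∀ k → fromℤ (k ℤ.* area t) ≡ ι 0
    n≡0 k = begin
      fromℤ (k ℤ.* area t)          ≡⟨ fromℤ-* k (area t) ⟩
      fromℤ k ⊛ ι (2 * suc t * suc t) ≡⟨ cong (λ g → fromℤ k ⊛ ι (2 * g * g)) (+-comm 1 t) ⟩
      fromℤ k ⊛ ι (2 * (t + 1) * (t + 1)) ≡⟨ cong (λ j → fromℤ k ⊛ ι j) n≡ ⟨
      fromℤ k ⊛ ι (suc m)      ≡⟨ cong (_⊛_ (fromℤ k)) ι-N ⟩
      fromℤ k ⊛ ι 0            ≡⟨ solve 1 (λ k → k :* con (+ 0) := con (+ 0)) refl (fromℤ k) ⟩
      ι 0                      ∎
      where open ≡-Reasoning
    slope≡ : fromℤ (slope t) ≡ ι {m} (suc (2 * t))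
    slope≡ = trans (fromℤ-+ (+ 1) (+ 2 ℤ.* + t)) (trans (cong (_⊕_ (ι 1)) (fromℤ-* (+ 2) (+ t)))
      (sym (trans (ι-+ 1 (2 * t)) (cong (_⊕_ (ι 1)) (ι-* 2 t)))))
    short : ∀ z l → z ⊖ fromℤ l ⊛ ι 1 ≡ fromℤ (+ toℕ z ℤ.- l)
    short z l = sym (trans (fromℤ-- (+ toℕ z) l) (cong₂ (_⊖_ {m}) (ι-toℕ z)
      (solve 1 (λ l → l := l :* con (+ 1)) refl (fromℤ l))))
    long : ∀ z l k → z ⊖ fromℤ l ⊛ ι (suc (2 * t)) ≡
      fromℤ (+ toℕ z ℤ.- l ℤ.* slope t ℤ.+ k ℤ.* area t)
    long z l k = sym (begin
      fromℤ (+ toℕ z ℤ.- l ℤ.* slope t ℤ.+ k ℤ.* area t)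
        ≡⟨ fromℤ-+ (+ toℕ z ℤ.- l ℤ.* slope t) (k ℤ.* area t) ⟩
      fromℤ (+ toℕ z ℤ.- l ℤ.* slope t) ⊕ fromℤ (k ℤ.* area t)
        ≡⟨ cong₂ (_⊕_ {m}) (fromℤ-- (+ toℕ z) (l ℤ.* slope t)) (n≡0 k) ⟩
      ι (toℕ z) ⊖ fromℤ (l ℤ.* slope t) ⊕ ι 0
        ≡⟨ cong₂ (λ u v → u ⊖ v ⊕ ι 0) (ι-toℕ z)
             (trans (fromℤ-* l (slope t)) (cong (_⊛_ (fromℤ l)) slope≡)) ⟩
      z ⊖ fromℤ l ⊛ ι (suc (2 * t)) ⊕ ι 0
        ≡⟨ solve 2 (λ z v → z :- v :+ con (+ 0) := z :- v) refl z (fromℤ l ⊛ ι (suc (2 * t))) ⟩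
      z ⊖ fromℤ l ⊛ ι (suc (2 * t)) ∎)
      where open ≡-Reasoning
    direct : _ → ∃[ q ] (CodeII {m} t q × Anticode t (z₁ , z₂) q)
    direct (l , k , near) = (fromℤ l ⊛ ι 1 , fromℤ l ⊛ ι (suc (2 * t))) , (fromℤ l , refl) ,
      fromℤ-anticode (z₁ , z₂) (fromℤ l ⊛ ι 1 , fromℤ l ⊛ ι (suc (2 * t)))
        (+ toℕ z₁ ℤ.- l) (+ toℕ z₂ ℤ.- l ℤ.* slope t ℤ.+ k ℤ.* area t)
        (short z₁ l) (long z₂ l k) near
    swapped : _ → ∃[ q ] (CodeII {m} t (swap q) × Anticode t (z₁ , z₂) q)
    swapped (l , k , near) = (fromℤ l ⊛ ι (suc (2 * t)) , fromℤ l ⊛ ι 1) , (fromℤ l , refl) ,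
      fromℤ-anticode (z₁ , z₂) (fromℤ l ⊛ ι (suc (2 * t)) , fromℤ l ⊛ ι 1)
        (+ toℕ z₁ ℤ.- l ℤ.* slope t ℤ.+ k ℤ.* area t) (+ toℕ z₂ ℤ.- l)
        (long z₁ l k) (short z₂ l) near

  equivalent-codeII-cover : ∀ t {C₀ : Code {m}} → suc m ≡ 2 * (t + 1) * (t + 1) →
    Equivalent C₀ (CodeII t) → ∀ z → ∃[ q ] (C₀ q × Anticode t z q)
  equivalent-codeII-cover t n≡ (inj₁ same) z =
    map₂ (λ {q} → map₁ (proj₂ (same q))) (proj₁ (codeII-cover t z n≡))
  equivalent-codeII-cover t n≡ (inj₂ swapped) z =
    map₂ (λ {q} → map₁ (proj₂ (swapped q))) (proj₂ (codeII-cover t z n≡))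

  -- The quarter turn of a perfect code

  rotation : Point {m} → Word
  rotation (x₁ , x₂) =
    pow τ₂ (toℕ x₁ + toℕ x₂ + 1) ++ pow τ₁ (toℕ x₁ + (suc m ∸ toℕ x₂)) ++ r

  -- This is the quarter turn about x: relative to x the cell (u , v) goes to (- v , u). The
  -- exponent `suc m ∸ toℕ x₂` represents - x₂.
  pull-rotation : ∀ (x₁ x₂ i j : Zn {m}) →
    pull (rotation (x₁ , x₂)) (i , j) ≡ (x₁ ⊕ x₂ ⊖ j , i ⊖ (x₁ ⊖ x₂))
  pull-rotation x₁ x₂ i j = trans (pull-τ₂ (toℕ x₁ + toℕ x₂ + 1) _ i j)
    (trans (pull-τ₁ (toℕ x₁ + (suc m ∸ toℕ x₂)) r i _) (cong₂ _,_
      (trans (cong (λ k → opposite (j ⊖ k)) (begin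
        ι (toℕ x₁ + toℕ x₂ + 1)         ≡⟨ ι-+ (toℕ x₁ + toℕ x₂) 1 ⟩
        x₁ ⊕ x₂ ⊕ ι 1                   ∎)) (opposite-⊖ j (x₁ ⊕ x₂)))
      (cong (_⊖_ i) (begin
        ι (toℕ x₁ + (suc m ∸ toℕ x₂))   ≡⟨ ι-+ (toℕ x₁) (suc m ∸ toℕ x₂) ⟩
        ι (toℕ x₁) ⊖ x₂                 ≡⟨ cong (_⊖ x₂) (ι-toℕ x₁) ⟩
        x₁ ⊖ x₂                         ∎))))
    where open ≡-Reasoning

  -- Relative to x the codeword l (a , b) is turned into l (- b , a), which is the codeword (l k) (a
  -- , b).
  respects-rotation : ∀ {P t a b} x → Tiling P (Ball t) (Gen1 a b) x →
    ∃[ k ] (k ⊛ a ≡ neg b × k ⊛ b ≡ a) → Respects P (rotation x)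
  respects-rotation {P} {t} {a} {b} x@(x₁ , x₂) tiling (k , ka≡-b , kb≡a) =
    respects {P = P} {Ball t} {Gen1 a b} {x} tiling (rotation x) move
    where
    f : Point {m} → Point {m}
    f (i , j) = x₁ ⊕ x₂ ⊖ j , i ⊖ (x₁ ⊖ x₂)
    iso : Isometry f
    iso (i , j) (i' , j') = trans
      (cong₂ _+_ (leeZ-flip (x₁ ⊕ x₂) j j') (leeZ-shift (x₁ ⊖ x₂) i i'))
      (+-comm (leeZ (j ⊖ j')) (leeZ (i ⊖ i')))
    turn : ∀ q₁ q₂ → Gen1 a b (q₁ ⊖ x₁ , q₂ ⊖ x₂) → Gen1 a b (f (q₁ , q₂) ⊖P x)
    turn q₁ q₂ (l , eq) = l ⊛ k , cong₂ _,_
      (begin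
        x₁ ⊕ x₂ ⊖ q₂ ⊖ x₁  ≡⟨ solve 3 (λ x y q → x :+ y :- q :- x := :- (q :- y)) refl x₁ x₂ q₂ ⟩
        neg (q₂ ⊖ x₂)      ≡⟨ cong (λ p → neg (proj₂ p)) eq ⟩
        neg (l ⊛ b)        ≡⟨ solve 2 (λ l b → :- (l :* b) := l :* :- b) refl l b ⟩
        l ⊛ neg b          ≡⟨ cong (_⊛_ l) ka≡-b ⟨
        l ⊛ (k ⊛ a)        ≡⟨ ⊛-assoc l k a ⟨
        l ⊛ k ⊛ a          ∎)
      (begin
        q₁ ⊖ (x₁ ⊖ x₂) ⊖ x₂ ≡⟨ solve 3 (λ x y q → q :- (x :- y) :- y := q :- x) refl x₁ x₂ q₁ ⟩
        q₁ ⊖ x₁            ≡⟨ cong proj₁ eq ⟩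
        l ⊛ a              ≡⟨ cong (_⊛_ l) kb≡a ⟨
        l ⊛ (k ⊛ b)        ≡⟨ ⊛-assoc l k b ⟨
        l ⊛ k ⊛ b          ∎)
      where open ≡-Reasoning
    move : ∀ q → Gen1 a b (q ⊖P x) → ∃[ q' ] (Gen1 a b (q' ⊖P x)
      × (∀ p → Ball t p q → Ball t (pull (rotation x) p) q'))
    move q@(q₁ , q₂) q∈ = f q , turn q₁ q₂ q∈ , λ { p@(i , j) near →
      subst (λ p' → Ball t p' (f q)) (sym (pull-rotation x₁ x₂ i j)) (ball-isometry f iso {p} {q} near) }

  ball-tiling : ∀ {P t C₀ x} {c : Fin (suc m) → Point {m}} →
    Enumerates c (Coset x C₀) → IsPalettePerfect t c P →
    BallsPartition C₀ t → Tiling P (Ball t) C₀ x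
  ball-tiling {P} {t} {C₀} {x} {c} enum palette balls =
    c , enum , (λ { (i , j) → palette i j }) , cover ,
    λ q → ≤-trans (≤-reflexive (dL-refl q)) z≤n
    where
    cover : ∀ p → ∃[ q ] (C₀ (q ⊖P x) × Ball t p q)
    cover p = go (balls (p ⊖P x))
      where
      go : ∃[ q ] (C₀ q × dL (p ⊖P x) q ≤ t × _) → ∃[ q ] (C₀ (q ⊖P x) × Ball t p q)
      go (q , q∈ , near , _) = q ⊕P x , subst C₀ (sym (⊕P-⊖P q x)) q∈ ,
        subst (_≤ t) (dL-unshift p q x) near

  -- If (u , v) = l (a , b) has u a unit and u² + v² = 0, then the quarter turn acts on
  -- Gen1 a b as multiplication by k = - v / u.
  rotation-scalar : ∀ (a b l e : Zn {m}) → l ⊛ a ⊛ e ≡ ι 1 →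
    l ⊛ a ⊛ (l ⊛ a) ⊕ l ⊛ b ⊛ (l ⊛ b) ≡ ι 0 →
    ∃[ k ] (k ⊛ a ≡ neg b × k ⊛ b ≡ a)
  rotation-scalar a b l e ue≡1 norm≡0 = neg (v ⊛ e) ,
    (begin
      neg (v ⊛ e) ⊛ a     ≡⟨ pull-out v e a ⟩
      neg (v ⊛ a ⊛ e)     ≡⟨ cong (λ w → neg (w ⊛ e)) (exchange l a b) ⟩
      neg (u ⊛ b ⊛ e)     ≡⟨ exchange-neg u b e ⟩
      neg (u ⊛ e ⊛ b)     ≡⟨ cong (λ w → neg (w ⊛ b)) ue≡1 ⟩
      neg (ι 1 ⊛ b)       ≡⟨ cong neg (⊛-identityˡ b) ⟩
      neg b               ∎) ,
    (begin
      neg (v ⊛ e) ⊛ b                     ≡⟨ unit-intro (neg (v ⊛ e) ⊛ b) ⟩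
      neg (v ⊛ e) ⊛ b ⊛ ι 1               ≡⟨ cong (_⊛_ (neg (v ⊛ e) ⊛ b)) ue≡1 ⟨
      neg (v ⊛ e) ⊛ b ⊛ (u ⊛ e)           ≡⟨ regroup u v b e ⟩
      neg (u ⊛ b) ⊛ v ⊛ (e ⊛ e)           ≡⟨ cong (λ w → neg w ⊛ v ⊛ (e ⊛ e)) (exchange l a b) ⟨
      -- Here - v² is rewritten as u² - (u² + v²), so that only (u e)² a = a survives.
      neg (v ⊛ a) ⊛ v ⊛ (e ⊛ e)           ≡⟨ complete u v e a ⟩
      u ⊛ e ⊛ (u ⊛ e) ⊛ a ⊖ (u ⊛ u ⊕ v ⊛ v) ⊛ (e ⊛ e ⊛ a)
        ≡⟨ cong₂ (λ w z → w ⊛ w ⊛ a ⊖ z ⊛ (e ⊛ e ⊛ a)) ue≡1 norm≡0 ⟩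
      ι 1 ⊛ ι 1 ⊛ a ⊖ ι 0 ⊛ (e ⊛ e ⊛ a)   ≡⟨ collapse a (e ⊛ e ⊛ a) ⟩
      a                                   ∎)
    where
    open ≡-Reasoning
    u v : Zn {m}
    u = l ⊛ a
    v = l ⊛ b
    pull-out : ∀ (v e a : Zn {m}) → neg (v ⊛ e) ⊛ a ≡ neg (v ⊛ a ⊛ e)
    pull-out = solve 3 (λ v e a → :- (v :* e) :* a := :- (v :* a :* e)) refl
    exchange : ∀ (l a b : Zn {m}) → l ⊛ b ⊛ a ≡ l ⊛ a ⊛ b
    exchange = solve 3 (λ l a b → l :* b :* a := l :* a :* b) refl
    exchange-neg : ∀ (u b e : Zn {m}) → neg (u ⊛ b ⊛ e) ≡ neg (u ⊛ e ⊛ b)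
    exchange-neg = solve 3 (λ u b e → :- (u :* b :* e) := :- (u :* e :* b)) refl
    unit-intro : ∀ (u : Zn {m}) → u ≡ u ⊛ ι 1
    unit-intro = solve 1 (λ u → u := u :* con (+ 1)) refl
    regroup : ∀ (u v b e : Zn {m}) → neg (v ⊛ e) ⊛ b ⊛ (u ⊛ e) ≡ neg (u ⊛ b) ⊛ v ⊛ (e ⊛ e)
    regroup = solve 4 (λ u v b e → :- (v :* e) :* b :* (u :* e) := :- (u :* b) :* v :* (e :* e)) refl
    complete : ∀ (u v e a : Zn {m}) → neg (v ⊛ a) ⊛ v ⊛ (e ⊛ e) ≡
      u ⊛ e ⊛ (u ⊛ e) ⊛ a ⊖ (u ⊛ u ⊕ v ⊛ v) ⊛ (e ⊛ e ⊛ a)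
    complete = solve 4 (λ u v e a → :- (v :* a) :* v :* (e :* e) :=
      u :* e :* (u :* e) :* a :- (u :* u :+ v :* v) :* (e :* e :* a)) refl
    collapse : ∀ (a z : Zn {m}) → ι 1 ⊛ ι 1 ⊛ a ⊖ ι 0 ⊛ z ≡ a
    collapse = solve 2 (λ a z → con (+ 1) :* con (+ 1) :* a :- con (+ 0) :* z := a) refl

  -- The determinant of the codewords (1 + A, 2T - A) and (T + G, 1 + T - G) is 2T + 1, a unit
  -- whose square is -1, times (1 + A) - (T + G).
  det-cancel : ∀ (A G T : Zn {m}) → ι 2 ⊛ T ⊛ T ⊕ ι 2 ⊛ T ⊕ ι 1 ≡ ι 0 →
    (ι 1 ⊕ A) ⊛ (ι 1 ⊕ (T ⊖ G)) ≡ (T ⊕ (T ⊖ A)) ⊛ (T ⊕ G) → ι 1 ⊕ A ≡ T ⊕ G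
  det-cancel A G T R≡0 det = begin
    ι 1 ⊕ A
      -- Put D = (1 + A) - (T + G) and R = 2T² + 2T + 1. The determinant is (2T + 1) D and (2T + 1)²
      -- = 2R - 1, so D = 2 D R - (2T + 1) det.
      ≡⟨ solve 3 (λ A G T → con (+ 1) :+ A := T :+ G :+
           (con (+ 2) :* (con (+ 1) :+ A :- T :- G) :* (con (+ 2) :* T :* T :+ con (+ 2) :* T :+ con (+ 1))
            :- (con (+ 2) :* T :+ con (+ 1)) :*
               ((con (+ 1) :+ A) :* (con (+ 1) :+ (T :- G)) :- (T :+ (T :- A)) :* (T :+ G))))
           refl A G T ⟩
    T ⊕ G ⊕ (ι 2 ⊛ (ι 1 ⊕ A ⊖ T ⊖ G) ⊛ (ι 2 ⊛ T ⊛ T ⊕ ι 2 ⊛ T ⊕ ι 1)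
      ⊖ (ι 2 ⊛ T ⊕ ι 1) ⊛ ((ι 1 ⊕ A) ⊛ (ι 1 ⊕ (T ⊖ G)) ⊖ (T ⊕ (T ⊖ A)) ⊛ (T ⊕ G)))
      ≡⟨ cong₂ (λ u v → T ⊕ G ⊕ (ι 2 ⊛ (ι 1 ⊕ A ⊖ T ⊖ G) ⊛ u
           ⊖ (ι 2 ⊛ T ⊕ ι 1) ⊛ (v ⊖ (T ⊕ (T ⊖ A)) ⊛ (T ⊕ G)))) R≡0 det ⟩
    T ⊕ G ⊕ (ι 2 ⊛ (ι 1 ⊕ A ⊖ T ⊖ G) ⊛ ι 0
      ⊖ (ι 2 ⊛ T ⊕ ι 1) ⊛ ((T ⊕ (T ⊖ A)) ⊛ (T ⊕ G) ⊖ (T ⊕ (T ⊖ A)) ⊛ (T ⊕ G)))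
      ≡⟨ solve 3 (λ A G T → T :+ G :+
           (con (+ 2) :* (con (+ 1) :+ A :- T :- G) :* con (+ 0)
            :- (con (+ 2) :* T :+ con (+ 1)) :*
               ((T :+ (T :- A)) :* (T :+ G) :- (T :+ (T :- A)) :* (T :+ G)))
            := T :+ G) refl A G T ⟩
    T ⊕ G ∎
    where open ≡-Reasoning

  -- Codewords of a perfect code with coordinate sum 2t + 1

  module PerfectCode (t : ℕ) (a b : Zn {m}) (n≡ : suc m ≡ 2 * t * t + 2 * t + 1)
    (minDist : MinLeeDist (Gen1 a b) (2 * t + 1)) (balls : BallsPartition (Gen1 a b) t) where

    t+t<n : t + t < suc m
    t+t<n = begin
      suc (t + t)              ≡⟨ cong (λ s → suc (t + s)) (+-identityʳ t) ⟨
      suc (2 * t)              ≡⟨ +-comm 1 (2 * t) ⟩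
      2 * t + 1                ≤⟨ m≤n+m (2 * t + 1) (2 * t * t) ⟩
      2 * t * t + (2 * t + 1)  ≡⟨ +-assoc (2 * t * t) (2 * t) 1 ⟨
      2 * t * t + 2 * t + 1    ≡⟨ n≡ ⟨
      suc m                    ∎
      where open ≤-Reasoning

    modulus≡0 : ι 2 ⊛ ι t ⊛ ι t ⊕ ι 2 ⊛ ι t ⊕ ι 1 ≡ ι {m} 0
    modulus≡0 = begin
      ι 2 ⊛ ι t ⊛ ι t ⊕ ι 2 ⊛ ι t ⊕ ι 1 ≡⟨ cong (λ u → u ⊛ ι t ⊕ u ⊕ ι 1) (ι-* 2 t) ⟨
      ι (2 * t) ⊛ ι t ⊕ ι (2 * t) ⊕ ι 1 ≡⟨ cong (λ u → u ⊕ ι (2 * t) ⊕ ι 1) (ι-* (2 * t) t) ⟨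
      ι (2 * t * t) ⊕ ι (2 * t) ⊕ ι 1   ≡⟨ cong (_⊕ ι 1) (ι-+ (2 * t * t) (2 * t)) ⟨
      ι (2 * t * t + 2 * t) ⊕ ι 1       ≡⟨ ι-+ (2 * t * t + 2 * t) 1 ⟨
      ι (2 * t * t + 2 * t + 1)         ≡⟨ cong ι n≡ ⟨
      ι (suc m)                         ≡⟨ ι-N ⟩
      ι 0                               ∎
      where open ≡-Reasoning

    -- The point (p + 1 , p' + 1) has weight t + 1, so the codeword whose ball contains it is
    -- nonzero and has weight at least 2t + 1. `beyond` then determines the position of that
    -- codeword.
    outward : ∀ p p' → suc p + suc p' ≡ suc t →
      ∃[ l ] ∃[ α ] ∃[ α' ] (α + α' ≡ t × l ⊛ a ≡ ι (suc p + α) × l ⊛ b ≡ ι (suc p' + α'))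
    outward p p' p+p'≡ = go (balls (ι (suc p) , ι (suc p')))
      where
      small : ∀ {p p'} → suc p + suc p' ≡ suc t → suc p ≤ t
      small {p} {p'} eq = m+n≤o⇒m≤o (suc p) {p'}
        (≤-reflexive (trans (sym (+-suc p p')) (suc-injective eq)))
      weight : ∀ {p} → suc p ≤ t → leeZ {m} (ι (suc p)) ≡ suc p
      weight {p} p≤t = leeZ-small (≤-trans (+-mono-≤ p≤t p≤t) (<⇒≤ t+t<n))
        (≤-<-trans (≤-trans p≤t (m≤m+n t t)) t+t<n)
      -- The zero codeword occurs as `(ι 0 ⊛ a , ι 0 ⊛ b)`, the form in which `Gen1` contains it.
      ⊖0⊛ : ∀ (u v : Zn {m}) → u ⊖ ι 0 ⊛ v ≡ u
      ⊖0⊛ = solve 2 (λ u v → u :- con (+ 0) :* v := u) refl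
      -- An integer representative w of the difference between point and codeword yields the
      -- representative p + 1 - w of the codeword entry.
      residual : ∀ p (u : Zn {m}) w → fromℤ w ≡ ι (suc p) ⊖ u → u ≡ fromℤ (+ suc p ℤ.- w)
      residual p u w ew = begin
        u                              ≡⟨ solve 2 (λ q u → u := q :- (q :- u)) refl (ι (suc p)) u ⟩
        ι (suc p) ⊖ (ι (suc p) ⊖ u)    ≡⟨ cong (_⊖_ (ι (suc p))) ew ⟨
        ι (suc p) ⊖ fromℤ w            ≡⟨ fromℤ-- (+ suc p) w ⟨
        fromℤ (+ suc p ℤ.- w)          ∎
        where open ≡-Reasoning
      bound : ∀ u v w → u ≡ fromℤ w → leeZ {m} (u ⊖ ι 0 ⊛ v) ≤ ∣ w ∣
      bound u v w eq = ≤-trans (≤-reflexive (cong leeZ (trans (⊖0⊛ u v) eq))) (leeZ-fromℤ-≤ w)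
      Outward : Set
      Outward = ∃[ l ] ∃[ α ] ∃[ α' ] (α + α' ≡ t × l ⊛ a ≡ ι (suc p + α) × l ⊛ b ≡ ι (suc p' + α'))
      go : ∃[ c ] (Gen1 a b c × dL {m} (ι (suc p) , ι (suc p')) c ≤ t × _) → Outward
      go (_ , (l , refl) , near , _) = go' (leeZ-lift (ι (suc p) ⊖ l ⊛ a)) (leeZ-lift (ι (suc p') ⊖ l ⊛ b))
        where
        -- The zero codeword is at distance t + 1 from the point, too far for its ball.
        nonzero : (l ⊛ a , l ⊛ b) ≢ (ι 0 ⊛ a , ι 0 ⊛ b)
        nonzero eq = 1+n≰n (begin
          suc t                               ≡⟨ p+p'≡ ⟨
          suc p + suc p'
            ≡⟨ cong₂ _+_ (weight (small p+p'≡)) (weight (small (trans (+-comm (suc p') (suc p)) p+p'≡))) ⟨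
          leeZ {m} (ι (suc p)) + leeZ {m} (ι (suc p'))
            ≡⟨ cong₂ (λ u v → leeZ {m} u + leeZ {m} v) (⊖0⊛ (ι (suc p)) a) (⊖0⊛ (ι (suc p')) b) ⟨
          dL {m} (ι (suc p) , ι (suc p')) (ι 0 ⊛ a , ι 0 ⊛ b)
            ≡⟨ cong (dL {m} (ι (suc p) , ι (suc p'))) eq ⟨
          dL {m} (ι (suc p) , ι (suc p')) (l ⊛ a , l ⊛ b) ≤⟨ near ⟩
          t                                   ∎)
          where open ≤-Reasoning
        go' : ∃[ w ] (fromℤ w ≡ ι (suc p) ⊖ l ⊛ a × ∣ w ∣ ≡ leeZ (ι (suc p) ⊖ l ⊛ a)) →
          ∃[ w ] (fromℤ w ≡ ι (suc p') ⊖ l ⊛ b × ∣ w ∣ ≡ leeZ (ι (suc p') ⊖ l ⊛ b)) → Outward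
        go' (w , ew , lw) (w' , ew' , lw') = finish (beyond w w' p+p'≡
            (≤-trans (≤-reflexive (cong₂ _+_ lw lw')) near)
            (≤-trans (proj₁ minDist (l ⊛ a , l ⊛ b) (ι 0 ⊛ a , ι 0 ⊛ b) (l , refl) (ι 0 , refl) nonzero)
              (+-mono-≤ (bound (l ⊛ a) a (+ suc p ℤ.- w) (residual p (l ⊛ a) w ew))
                        (bound (l ⊛ b) b (+ suc p' ℤ.- w') (residual p' (l ⊛ b) w' ew')))))
          where
          finish : ∃[ α ] ∃[ α' ] (α + α' ≡ t × + suc p ℤ.- w ≡ + (suc p + α)
            × + suc p' ℤ.- w' ≡ + (suc p' + α')) → Outward
          finish (α , α' , α+α'≡ , eq , eq') = l , α , α' , α+α'≡ ,
            trans (residual p (l ⊛ a) w ew) (cong fromℤ eq) ,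
            trans (residual p' (l ⊛ b) w' ew') (cong fromℤ eq')

    ι-complement : ∀ {α β} → α + β ≡ t → ι {m} β ≡ ι t ⊖ ι α
    ι-complement {α} {β} refl = begin
      ι β                 ≡⟨ solve 2 (λ a b → b := a :+ b :- a) refl (ι α) (ι β) ⟩
      ι α ⊕ ι β ⊖ ι α     ≡⟨ cong (_⊖ ι α) (ι-+ α β) ⟨
      ι (α + β) ⊖ ι α     ∎
      where open ≡-Reasoning

    complement : ∀ k α β → α + β ≡ t → ι {m} (k + β) ≡ ι k ⊕ (ι t ⊖ ι α)
    complement k α β eq = trans (ι-+ k β) (cong (_⊕_ (ι k)) (ι-complement {α} {β} eq))

    -- Two multiples of (a , b) have determinant 0, so `det-cancel` equates the first entries modulo
    -- n. Both are at most 2t < n, hence equal as numbers.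
    same-side : ∀ {l l' α β γ δ} → 1 ≤ t → α + β ≡ t → γ + δ ≡ t →
      l ⊛ a ≡ ι (1 + α) → l ⊛ b ≡ ι (t + β) → l' ⊛ a ≡ ι (t + γ) → l' ⊛ b ≡ ι (1 + δ) →
      1 + α ≡ t + γ
    same-side {l} {l'} {α} {β} {γ} {δ} 1≤t αβ γδ la lb l'a l'b = begin
      1 + α
        ≡⟨ toℕ-ι-< (≤-<-trans (+-mono-≤ 1≤t (m+n≤o⇒m≤o α (≤-reflexive αβ))) t+t<n) ⟨
      toℕ (ι {m} (1 + α)) ≡⟨ cong toℕ ι≡ ⟩
      toℕ (ι {m} (t + γ))
        ≡⟨ toℕ-ι-< (≤-<-trans (+-monoʳ-≤ t (m+n≤o⇒m≤o γ (≤-reflexive γδ))) t+t<n) ⟩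
      t + γ               ∎
      where
      open ≡-Reasoning
      det : (ι 1 ⊕ ι α) ⊛ (ι 1 ⊕ (ι t ⊖ ι γ)) ≡ (ι t ⊕ (ι t ⊖ ι α)) ⊛ (ι t ⊕ ι γ)
      det = begin
        (ι 1 ⊕ ι α) ⊛ (ι 1 ⊕ (ι t ⊖ ι γ))
          ≡⟨ cong₂ (_⊛_ {m}) (trans la (ι-+ 1 α)) (trans l'b (complement 1 γ δ γδ)) ⟨
        l ⊛ a ⊛ (l' ⊛ b)
          ≡⟨ solve 4 (λ l l' a b → l :* a :* (l' :* b) := l :* b :* (l' :* a)) refl l l' a b ⟩
        l ⊛ b ⊛ (l' ⊛ a)
          ≡⟨ cong₂ (_⊛_ {m}) (trans lb (complement t α β αβ)) (trans l'a (ι-+ t γ)) ⟩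
        (ι t ⊕ (ι t ⊖ ι α)) ⊛ (ι t ⊕ ι γ)  ∎
      ι≡ : ι {m} (1 + α) ≡ ι (t + γ)
      ι≡ = trans (ι-+ 1 α) (trans (det-cancel (ι α) (ι γ) (ι t) modulus≡0 det) (sym (ι-+ t γ)))

    -- The sum t² + (t + 1)² is the modulus itself.
    norm≡0 : ι t ⊛ ι t ⊕ (ι 1 ⊕ ι t) ⊛ (ι 1 ⊕ ι t) ≡ ι {m} 0
    norm≡0 = trans (solve 1 (λ t → t :* t :+ (con (+ 1) :+ t) :* (con (+ 1) :+ t) :=
      con (+ 2) :* t :* t :+ con (+ 2) :* t :+ con (+ 1)) refl (ι t)) modulus≡0

    -- From - 2t(t + 1) = 1 - n: both t and t + 1 are units, with inverses - 2(t + 1) and - 2t.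
    unit : ι t ⊛ neg (ι 2 ⊛ (ι 1 ⊕ ι t)) ≡ ι {m} 1
    unit = trans (solve 1 (λ t → t :* :- (con (+ 2) :* (con (+ 1) :+ t)) :=
        con (+ 1) :- (con (+ 2) :* t :* t :+ con (+ 2) :* t :+ con (+ 1))) refl (ι t))
      (trans (cong (_⊖_ (ι 1)) modulus≡0) (solve 0 (con (+ 1) :- con (+ 0) := con (+ 1)) refl))

    scalar-from-t,1+t : ∀ l → l ⊛ a ≡ ι t → l ⊛ b ≡ ι 1 ⊕ ι t → ∃[ k ] (k ⊛ a ≡ neg b × k ⊛ b ≡ a)
    scalar-from-t,1+t l la lb = rotation-scalar a b l (neg (ι 2 ⊛ (ι 1 ⊕ ι t)))
      (trans (cong (_⊛ neg (ι 2 ⊛ (ι 1 ⊕ ι t))) la) unit)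
      (trans (cong₂ (λ u v → u ⊛ u ⊕ v ⊛ v) la lb) norm≡0)

    scalar-from-1+t,t : ∀ l → l ⊛ a ≡ ι 1 ⊕ ι t → l ⊛ b ≡ ι t → ∃[ k ] (k ⊛ a ≡ neg b × k ⊛ b ≡ a)
    scalar-from-1+t,t l la lb = rotation-scalar a b l (neg (ι 2 ⊛ ι t))
      (trans (cong (_⊛ neg (ι 2 ⊛ ι t)) la)
        (trans (solve 1 (λ t → (con (+ 1) :+ t) :* :- (con (+ 2) :* t) :=
          t :* :- (con (+ 2) :* (con (+ 1) :+ t))) refl (ι t)) unit))
      (trans (cong₂ (λ u v → u ⊛ u ⊕ v ⊛ v) la lb)
        (trans (⊕-comm ((ι 1 ⊕ ι t) ⊛ (ι 1 ⊕ ι t)) (ι t ⊛ ι t)) norm≡0))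

  trivial-modulus : suc m ≡ 1 → (u v : Zn {m}) → u ≡ v
  trivial-modulus eq u v = toℕ-injective (trans (n<1⇒n≡0 (subst (toℕ u <_) eq (toℕ<n u)))
    (sym (n<1⇒n≡0 (subst (toℕ v <_) eq (toℕ<n v)))))

  perfect-rotation : ∀ t (a b : Zn {m}) → suc m ≡ 2 * t * t + 2 * t + 1 →
    MinLeeDist (Gen1 a b) (2 * t + 1) → BallsPartition (Gen1 a b) t →
    ∃[ k ] (k ⊛ a ≡ neg b × k ⊛ b ≡ a)
  -- For t = 0 the modulus is 1 and all residues coincide.
  perfect-rotation zero a b n≡ _ _ = a , trivial-modulus n≡ _ _ , trivial-modulus n≡ _ _
  perfect-rotation (suc t) a b n≡ minDist balls =
    -- With T = `suc t` as radius, the two points are (1 , T) and (T , 1), both of weight T + 1.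
    go (outward 0 t refl) (outward t 0 (+-comm (suc t) 1))
    where
    open PerfectCode (suc t) a b n≡ minDist balls
    go : _ → _ → _
    go (l , α , β , αβ , la , lb) (l' , γ , δ , γδ , l'a , l'b) =
      corner γ γδ l'a (same-side {l} {l'} (s≤s z≤n) αβ γδ la lb l'a l'b)
      where
      -- Since α ≤ T for T = `suc t`, the equation 1 + α = T + γ forces γ ≤ 1. The codeword is (T ,
      -- T + 1) for γ = 0 and (T + 1 , T) for γ = 1.
      corner : ∀ γ → γ + δ ≡ suc t → l' ⊛ a ≡ ι (suc t + γ) → 1 + α ≡ suc t + γ → _
      corner zero refl l'a _ = scalar-from-t,1+t l'
        (trans l'a (cong ι (+-identityʳ (suc t)))) (trans l'b (ι-+ 1 (suc t)))
      corner (suc zero) refl l'a _ = scalar-from-1+t,t l'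
        (trans l'a (trans (cong ι (+-comm (suc t) 1)) (ι-+ 1 (suc t)))) l'b
      corner (suc (suc γ)) _ _ eq = ⊥-elim (m+1+n≰m (suc t) (begin
        suc t + suc γ  ≡⟨ suc-injective (trans eq (+-suc (suc t) (suc γ))) ⟨
        α              ≤⟨ m+n≤o⇒m≤o α (≤-reflexive αβ) ⟩
        suc t          ∎))
        where open ≤-Reasoning

  -- The generators of the groups

  codeI-diagonal : ∀ t → CodeI {m} t (ι (t + 1) , ι (t + 1))
  codeI-diagonal t = ι 1 , ι 0 , cong₂ _,_ (trans t+1≡ (side₁ (ι (suc t))))
    (trans t+1≡ (side₂ (ι (suc t)) (ι (2 * suc t))))
    where
    t+1≡ : ι {m} (t + 1) ≡ ι (suc t)
    t+1≡ = cong ι (+-comm t 1)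
    side₁ : ∀ (g : Zn {m}) → g ≡ ι 1 ⊛ g
    side₁ = solve 1 (λ g → g := con (+ 1) :* g) refl
    side₂ : ∀ (g d : Zn {m}) → g ≡ ι 1 ⊛ g ⊕ ι 0 ⊛ d
    side₂ = solve 2 (λ g d → g := con (+ 1) :* g :+ con (+ 0) :* d) refl

  codeI-vertical : ∀ t → CodeI {m} t (ι 0 , ι (2 * (t + 1)))
  codeI-vertical t = ι 0 , ι 1 , cong₂ _,_ (side₁ (ι (suc t)))
    (trans (cong (λ k → ι (2 * k)) (+-comm t 1)) (side₂ (ι (suc t)) (ι (2 * suc t))))
    where
    side₁ : ∀ (g : Zn {m}) → ι 0 ≡ ι 0 ⊛ g
    side₁ = solve 1 (λ g → con (+ 0) := con (+ 0) :* g) refl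
    side₂ : ∀ (g d : Zn {m}) → d ≡ ι 0 ⊛ g ⊕ ι 1 ⊛ d
    side₂ = solve 2 (λ g d → d := con (+ 0) :* g :+ con (+ 1) :* d) refl

  pull-vertical : ∀ k (p : Point {m}) → pull (pow τ₂ k) p ≡ p ⊖P (ι 0 , ι k)
  pull-vertical k (i , j) = trans (pull-pow-τ₂ k i j)
    (cong (_, j ⊖ ι k) (solve 1 (λ i → i := i :- con (+ 0)) refl i))

  setting-respects : ∀ {P : Grid {m}} {gens} → Setting P gens → ∀ {g} → g ∈ gens → Respects P g
  setting-respects {P} (perfect t a b x c n≡ minDist balls enum palette) = generators
    where
    tiling : Tiling P (Ball t) (Gen1 a b) x
    tiling = ball-tiling {P = P} {t} {Gen1 a b} {x} {c} enum palette balls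
    generators : ∀ {g} → g ∈ _ → Respects P g
    generators (here refl) =
      respects-rotation {P = P} {t} {a} {b} x tiling (perfect-rotation t a b n≡ minDist balls)
    generators (there (here refl)) =
      respects-shift {P = P} {Ball t} {Gen1 a b} {x} tiling (gen1-subtractive a b)
        (λ {p} {q} v → ball-isometry {t = t} (_⊖P v) (shift-isometry v) {p} {q})
        (pow τ₁ (toℕ a) ++ pow τ₂ (toℕ b)) (a , b) (gen1-generator a b) (pull-gen1 a b)
  setting-respects {P} (diamI t C₀ x c n≡ _ _ equiv enum palette) = generators
    where
    tiling : Tiling P (Anticode t) (CodeI t) x
    -- Equivalence makes `C₀` and `CodeI t` contain the same points, so the explicit code is used
    -- throughout this case.
    tiling = diam-tiling {P = P} {t} {CodeI t} {x} {c}
      (enumerates-cong {c = c} {x} {C₀} {CodeI t} (equivalent-codeI {t = t} {C₀} equiv) enum)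
      palette (codeI-cover t)
    shift : ∀ w v → CodeI t v → (∀ p → pull w p ≡ p ⊖P v) → Respects P w
    shift = respects-shift {P = P} {Anticode t} {CodeI t} {x} tiling (codeI-subtractive t)
      (λ {p} {q} → anticode-shift {t = t} {p} {q})
    generators : ∀ {g} → g ∈ _ → Respects P g
    generators (here refl) = shift (pow τ₁ (t + 1) ++ pow τ₂ (t + 1)) (ι (t + 1) , ι (t + 1))
      (codeI-diagonal t) (pull-translation (t + 1) (t + 1))
    generators (there (here refl)) = shift (pow τ₂ (2 * (t + 1))) (ι 0 , ι (2 * (t + 1)))
      (codeI-vertical t) (pull-vertical (2 * (t + 1)))
    generators (there (there (here refl))) = respects-mirror {P = P} {t} {CodeI t} x tiling (codeI-mirror t)
    generators (there (there (there (here refl)))) =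
      respects-halfturn {P = P} {t} {CodeI t} x tiling (codeI-subtractive t)
  setting-respects {P} (diamII t a b x c n≡ _ equiv enum palette) = generators
    where
    tiling : Tiling P (Anticode t) (Gen1 a b) x
    tiling = diam-tiling {P = P} {t} {Gen1 a b} {x} {c} enum palette 
      (equivalent-codeII-cover t {Gen1 a b} n≡ equiv)
    generators : ∀ {g} → g ∈ _ → Respects P g
    generators (here refl) =
      respects-shift {P = P} {Anticode t} {Gen1 a b} {x} tiling (gen1-subtractive a b)
        (λ {p} {q} → anticode-shift {t = t} {p} {q})
        (pow τ₁ (toℕ a) ++ pow τ₂ (toℕ b)) (a , b) (gen1-generator a b) (pull-gen1 a b)
    generators (there (here refl)) = respects-halfturn {P = P} {t} {Gen1 a b} x tiling (gen1-subtractive a b)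

theorem12 : (m : ℕ) (P : Grid {m}) (gens : List Word) → Setting P gens →
    (S₁ S₂ : Grid {m}) (φ : Word) → InGroup gens φ →
    IsSudoku P S₁ → IsSudoku P S₂ → S₂ ≗₂ act φ S₁ →
    (∀ G → IsMinimal P S₁ G → IsMinimal P S₂ (act φ G))
    × (∀ G G' → IsMinimal P S₁ G → IsMinimal P S₁ G' →
    act φ G ≗₂ act φ G' → G ≗₂ G')
    × (∀ H → IsMinimal P S₂ H → ∃[ G ] (IsMinimal P S₁ G × act φ G ≗₂ H))
theorem12 m P gens setting S₁ S₂ φ φ∈ _ _ =
  transport φ (group-respects (setting-respects setting) φ∈)
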